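{- Let $\mathbf{R}$ be an ordered field, let $\mathfrak{N}$ be a non-trivial linearly ordered abelian group and let $\mathbb{T}=\mathbf{R}[[\mathfrak{N}]]$. Suppose that $(\mathbb{T},\log)$ is an exponentially closed transserial field, that $\partial$ is a flat transserial derivation on $\mathbb{T}$ with identity $x$, and that $(\mathbb{T},\partial)$ is an H-field. Let $\circ:\mathbb{T}\times\mathbb{T}^{>,\succ}\to\mathbb{T}$ be a flat transserial composition law with identity $x$, and assume that $(\partial,\circ)$ satisfies the chain rule and that $(\mathbb{T},\partial,\circ)$ has Taylor expansions. Let $\mathfrak{M}\subseteq\mathfrak{N}$ be a subgroup containing $x$ such that $\mathbb{S}=\mathbf{R}[[\mathfrak{M}]]$ is a differential subfield of $\mathbb{T}$ (i.e. $\partial(\mathbb{S})\subseteq\mathbb{S}$) and such that $\mathfrak{m}\circ(x+\delta)\in\mathbb{S}$ whenever $\mathfrak{m}\in\mathfrak{M}$ and $\delta\in\mathbb{S}$ with $\delta\prec x$. Then the class $\mathcal{G}:=\{x+\delta : \delta\in\mathbb{S},\ \delta\prec x\}$ is a group under the composition $\circ$.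
   Context: Well-based series. The set theory is NBG; groups and fields may be proper classes. For an ordered field $\mathbf{R}$ and a linearly ordered abelian group $(\mathfrak{M},\cdot,1,\prec)$, $\mathbf{R}[[\mathfrak{M}]]$ is the ordered field of functions $s:\mathfrak{M}\to\mathbf{R}$ whose support $\operatorname{supp}s=\{\mathfrak{m}:s(\mathfrak{m})\neq0\}$ is a set that is well-ordered for the reverse order $\succ$, with pointwise sum and Cauchy product; $s>0$ iff $s\neq0$ and $s(\max\operatorname{supp}s)>0$. Elements of $\mathfrak{M}$ (monomials) and of $\mathbf{R}$ are identified with series. For $s\neq0$, $\mathfrak{d}(s)=\max\operatorname{supp}s$. Write $s\prec t$ if $r|s|<|t|$ for all $r\in\mathbf{R}^{>}$; $s\preccurlyeq t$ if not $t\prec s$. For $\mathbb{S}=\mathbf{R}[[\mathfrak{M}]]$ put $\mathbb{S}_{\succ}=\{s:\operatorname{supp}s\succ1\}$ and $\mathbb{S}^{>,\succ}=\{s:s>\mathbf{R}\}$. A family $(s_i)_{i\in I}$ is summable if $\bigcup_i\operatorname{supp}s_i$ is a set well-ordered by $\succ$ and each monomial lies in finitely many $\operatorname{supp}s_i$; its sum is taken coefficientwise. An $\mathbf{R}$-linear map $\Phi$ is strongly linear if it maps summable families to summable families and commutes with their sums. Transserial fields. Let $\mathbb{T}=\mathbf{R}[[\mathfrak{N}]]$ and let $\log:(\mathbb{T}^{>},\cdot,1,<)\to(\mathbb{T},+,0,<)$ be an embedding of ordered groups. $(\mathbb{T},\log)$ is a transserial field if $\log\mathfrak{N}\subseteq\mathbb{T}_{\succ}$;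 $\log s\leqslant s-1$ for all $s\in\mathbb{T}^{>}$; $\log(1+\varepsilon)=\sum_{k>0}\frac{(-1)^{k+1}}{k}\varepsilon^k$ for all $\varepsilon\prec1$; and $\log$ restricts to an isomorphism of ordered groups $(\mathbf{R}^{>},\cdot)\to(\mathbf{R},+)$. It is exponentially closed if $\log:\mathbb{T}^{>}\to\mathbb{T}$ is surjective. For $s,t\in\mathbb{T}^{\times}$ write $s\prec\!\!\prec t$ if $\log|s|\prec\log|t|$, and $s\preccurlyeq\!\!\preccurlyeq t$ if $\log|s|\preccurlyeq\log|t|$. Derivations. A transserial derivation on $\mathbb{T}$ is a strongly linear $\partial:\mathbb{T}\to\mathbb{T}$ satisfying the Leibniz rule and $\partial(\log|s|)=\partial(s)/s$ for $s\neq0$; write $f'=\partial(f)$ and $f^{(k)}=\partial^k(f)$. An identity of $\partial$ is an $x\in\mathbb{T}^{>}$ with $1\notin\operatorname{supp}x$ and $\partial(x)=1$. $(\mathbb{T},\partial)$ is an H-field if $\ker\partial=\mathbf{R}$ and $f'>0$ for all $f\in\mathbb{T}^{>,\succ}$. In that case $\partial$ (with identity $x$) is flat if for all $\mathfrak{m}\in\mathfrak{N}$ and $\mathfrak{n}\in\operatorname{supp}\partial(\mathfrak{m})$ there are $\mathfrak{f},\mathfrak{w}\in\mathfrak{N}$ with $\mathfrak{f}\prec\!\!\prec\mathfrak{m}$, $\mathfrak{w}\preccurlyeq\!\!\preccurlyeq x$ and $\mathfrak{n}=\mathfrak{m}\mathfrak{f}\mathfrak{w}$. Composition laws. A transserial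 composition law on $\mathbb{T}$ is a map $\circ:\mathbb{T}\times\mathbb{T}^{>,\succ}\to\mathbb{T}$ such that for each $s\in\mathbb{T}^{>,\succ}$ the map $f\mapsto f\circ s$ is a strongly linear morphism of ordered rings commuting with $\log$, and $f\circ(s\circ t)=(f\circ s)\circ t$ for all $f\in\mathbb{T}$, $s,t\in\mathbb{T}^{>,\succ}$. Its identity is an $x\in\mathbb{T}^{>,\succ}$ with $x\circ s=s$ and $f\circ x=f$ for all such $s,f$. It is flat if for all $s\in\mathbb{T}^{>,\succ}$, $\mathfrak{m}\in\mathfrak{N}\setminus\{1\}$ and $\mathfrak{n}\in\operatorname{supp}(\mathfrak{m}\circ s)$ there are $\mathfrak{f},\mathfrak{w}\in\mathfrak{N}$ and $\mathfrak{u}\in\operatorname{supp}s$ with $\mathfrak{f}\prec\!\!\prec\mathfrak{m}$, $\mathfrak{w}\preccurlyeq1$, $\mathfrak{w}\preccurlyeq\!\!\preccurlyeq\mathfrak{u}$ and $\mathfrak{n}=\mathfrak{d}(\mathfrak{m}\circ s)\mathfrak{f}\mathfrak{w}$. $(\partial,\circ)$ satisfies the chain rule if $(f\circ s)'=s'\cdot(f'\circ s)$ for all $f\in\mathbb{T}$, $s\in\mathbb{T}^{>,\succ}$. A series $f$ is in Taylor configuration at $(s,\delta)$ ($s\in\mathbb{T}^{>,\succ}$, $\delta\in\mathbb{T}$) if $\delta\prec s$ and $(\mathfrak{m}'\circ s)\delta\prec\mathfrak{m}\circ s$ for all $\mathfrak{m}\in\operatorname{supp}f$. $(\mathbb{T},\partial,\circ)$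 has Taylor expansions if whenever $f$ is in Taylor configuration at $(s,\delta)$, the family $((\mathfrak{m}^{(k)}\circ s)\delta^k)_{\mathfrak{m}\in\operatorname{supp}f,\,k\in\mathbb{N}}$ is summable, $f\circ(s+\delta)=\sum_{k}\frac{f^{(k)}\circ s}{k!}\delta^k=\sum_{\mathfrak{m}\in\operatorname{supp} f,\,k}f(\mathfrak{m})\frac{\mathfrak{m}^{(k)}\circ s}{k!}\delta^k$, and $(f^{(k)}\circ s)\delta^k\succ(f^{(k+1)}\circ s)\delta^{k+1}$ for every $k$ with $(f^{(k)}\circ s)\delta^k\neq0$. -}

module Defs where

open import Algebra.Bundles using (AbelianGroup; CommutativeRing; Semiring)
import Algebra.Definitions.RawSemiring as RawSemiringDefs
open import Algebra.Core using (Op₁)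
open import Algebra.Structures using (IsGroup)
import Algebra.Properties.AbelianGroup as AbelianGroupProperties
import Algebra.Properties.CommutativeSemigroup as CommutativeSemigroupProperties
import Algebra.Properties.Ring as RingProperties
open import Axiom.ExcludedMiddle using (ExcludedMiddle)
open import Data.List.Base using (List; []; _∷_; foldr)
import Data.List.Membership.Setoid as ListMembership
open import Data.List.Relation.Unary.All as All using (All; []; _∷_)
open import Data.List.Relation.Unary.AllPairs using ([]; _∷_)
open import Data.List.Relation.Unary.Any using (here; there)
import Data.List.Relation.Unary.Unique.Setoid as ListUnique
open import Data.Nat.Base using (ℕ; zero; suc; _!)
open import Data.Product.Base using (Σ; Σ-syntax; ∃; ∃-syntax; _×_; _,_; proj₁; proj₂; map₂)
open import Data.Product.Relation.Binary.Pointwise.NonDependent using (×-setoid)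
open import Data.Sum.Base using (_⊎_; inj₁; inj₂)
open import Data.Unit.Polymorphic using (⊤; tt)
open import Function.Base using (_on_)
open import Function.Bundles using (Func; _⇔_)
import Function.Construct.Composition as Compose
open import Induction.WellFounded using (WellFounded; Acc; acc)
open import Level using (Level; _⊔_) renaming (suc to lsuc)
open import Relation.Binary.Bundles using (Setoid)
open import Relation.Binary.Core using (Rel)
open import Relation.Binary.Definitions using (tri<; tri≈; tri>; _Respects_)
import Relation.Binary.Construct.On as On
open import Relation.Binary.PropositionalEquality as ≡ using (_≡_)
import Relation.Binary.Reasoning.Setoid as SetoidReasoning
open import Relation.Binary.Structures using (IsStrictTotalOrder)
open import Relation.Nullary using (¬_; Dec; yes; no; contradiction)
open import Relation.Unary using (Pred; _⊆_; _∪_; _∈_; _∉_)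

record OrderedField c ℓ₁ ℓ₂ : Set (lsuc (c ⊔ ℓ₁ ⊔ ℓ₂)) where
  field
    commutativeRing : CommutativeRing c ℓ₁

  open CommutativeRing commutativeRing public

  infix  4 _<_
  infix  8 _⁻¹

  field
    _<_                : Rel Carrier ℓ₂
    isStrictTotalOrder : IsStrictTotalOrder _≈_ _<_
    0≉1                : ¬ (0# ≈ 1#)
    -- Total operation; its value at 0# is unconstrained.
    _⁻¹                : Op₁ Carrier
    ⁻¹-inverseʳ        : ∀ x → ¬ (x ≈ 0#) → x * x ⁻¹ ≈ 1#
    +-monoʳ-<          : ∀ x {y z} → y < z → x + y < x + z
    *-pos              : ∀ {x y} → 0# < x → 0# < y → 0# < x * y

  open IsStrictTotalOrder isStrictTotalOrder public
    using (compare; <-resp-≈; <-respˡ-≈; <-respʳ-≈)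
    renaming (trans to <-trans; irrefl to <-irrefl; asym to <-asym; _≟_ to _≈?_)

record OrderedAbelianGroup c ℓ₁ ℓ₂ : Set (lsuc (c ⊔ ℓ₁ ⊔ ℓ₂)) where
  field
    abelianGroup : AbelianGroup c ℓ₁

  open AbelianGroup abelianGroup public

  infix 4 _≺_ _≼_

  field
    _≺_                : Rel Carrier ℓ₂
    isStrictTotalOrder : IsStrictTotalOrder _≈_ _≺_
    ∙-monoʳ-≺          : ∀ x {y z} → y ≺ z → x ∙ y ≺ x ∙ z

  open IsStrictTotalOrder isStrictTotalOrder public
    using (compare)
    renaming ( _≟_ to _≈?_; trans to ≺-trans; irrefl to ≺-irrefl; asym to ≺-asym
             ; <-respˡ-≈ to ≺-respˡ-≈; <-respʳ-≈ to ≺-respʳ-≈)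

  _≼_ : Rel Carrier ℓ₂
  x ≼ y = ¬ (y ≺ x)

  NonTrivial : Set _
  NonTrivial = ∃[ x ] ¬ (x ≈ ε)

  record IsSubgroup {p} (P : Pred Carrier p) : Set (c ⊔ ℓ₁ ⊔ p) where
    field
      respects : P Respects _≈_
      ε-closed : P ε
      ∙-closed : ∀ {x y} → P x → P y → P (x ∙ y)
      ⁻¹-closed : ∀ {x} → P x → P (x ⁻¹)

module OrderedFieldLemmas {c ℓ₁ ℓ₂} (𝐑 : OrderedField c ℓ₁ ℓ₂) where
  open OrderedField 𝐑
  open RingProperties ring

  +-pos : ∀ {x y} → 0# < x → 0# < y → 0# < x + y
  +-pos {x} {y} 0<x 0<y =
    <-trans 0<x (<-respˡ-≈ (+-identityʳ x) (+-monoʳ-< x 0<y))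

  neg⇒-pos : ∀ {x} → x < 0# → 0# < - x
  neg⇒-pos {x} x<0 =
    <-respʳ-≈ (+-identityʳ (- x)) (<-respˡ-≈ (-‿inverseˡ x) (+-monoʳ-< (- x) x<0))

  pos⇒≉0 : ∀ {x} → 0# < x → ¬ (x ≈ 0#)
  pos⇒≉0 0<x x≈0 = <-irrefl (sym x≈0) 0<x

  0<1 : 0# < 1#
  0<1 with compare 0# 1#
  ... | tri< p _ _ = p
  ... | tri≈ _ p _ = contradiction p 0≉1
  ... | tri> _ _ p = contradiction
    (<-respʳ-≈ (trans (sym (-‿distribˡ-* 1# (- 1#)))
                (trans (-‿cong (*-identityˡ (- 1#))) (-‿involutive 1#)))
       (*-pos (neg⇒-pos p) (neg⇒-pos p)))
    (λ q → <-asym p q)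

  *-nonzero : ∀ {x y} → ¬ (x ≈ 0#) → ¬ (y ≈ 0#) → ¬ (x * y ≈ 0#)
  *-nonzero {x} {y} x≉0 y≉0 xy≈0 = y≉0 (begin
    y                ≈⟨ *-identityˡ y ⟨
    1# * y           ≈⟨ *-congʳ (⁻¹-inverseʳ x x≉0) ⟨
    (x * x ⁻¹) * y   ≈⟨ *-congʳ (*-comm x (x ⁻¹)) ⟩
    (x ⁻¹ * x) * y   ≈⟨ *-assoc _ _ _ ⟩
    x ⁻¹ * (x * y)   ≈⟨ *-congˡ xy≈0 ⟩
    x ⁻¹ * 0#        ≈⟨ zeroʳ _ ⟩
    0#               ∎)
    where open SetoidReasoning setoid

-- The set theory is modelled by two universes: classes live in Set ℓ and
-- sets in Set κ, so that κ < ℓ allows 𝐑 and 𝔑 to be proper classes.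
-- Excluded middle makes the ambient logic classical; applied to
-- arbitrary types it also provides global choice.
module WellBasedSeries
  (em : ∀ {a} → ExcludedMiddle a) (κ : Level) {ℓ : Level}
  (𝐑 : OrderedField ℓ ℓ ℓ) (𝔑 : OrderedAbelianGroup ℓ ℓ ℓ) where

  module R where
    open OrderedField 𝐑 public
    open OrderedFieldLemmas 𝐑 public
    open RingProperties ring public
    open RawSemiringDefs (Semiring.rawSemiring semiring) public
      using (_^_) renaming (_×_ to _·_)
  module N where
    open OrderedAbelianGroup 𝔑 public
    open AbelianGroupProperties abelianGroup public

  Monomial : Set ℓ
  Monomial = N.Carrier

  -- P is contained in the range of a set-indexed family, that is (by
  -- separation) P is a set.
  Small : ∀ {p} → Pred Monomial p → Set (lsuc κ ⊔ ℓ ⊔ p)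
  Small P = Σ[ A ∈ Set κ ] Σ[ f ∈ (A → Monomial) ]
              (∀ {𝔪} → P 𝔪 → ∃[ a ] f a N.≈ 𝔪)

  Reverse : ∀ {p} (P : Pred Monomial p) → Rel (Σ Monomial P) ℓ
  Reverse P 𝔫 𝔪 = proj₁ 𝔪 N.≺ proj₁ 𝔫

  -- P is well-ordered by the reverse order ≻.
  ReverseWellOrdered : ∀ {p} → Pred Monomial p → Set (ℓ ⊔ p)
  ReverseWellOrdered P = WellFounded (Reverse P)

  WellBased : ∀ {p} → Pred Monomial p → Set (lsuc κ ⊔ ℓ ⊔ p)
  WellBased P = Small P × ReverseWellOrdered P

  Greatest : ∀ {q} → Pred Monomial q → Pred Monomial (ℓ ⊔ q)
  Greatest Q 𝔪 = 𝔪 ∈ Q × (∀ {𝔫} → 𝔫 ∈ Q → 𝔫 N.≼ 𝔪)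

  greatest : ∀ {P : Pred Monomial ℓ} {q} {Q : Pred Monomial q} →
             ReverseWellOrdered P → Q ⊆ P → ∃ Q → ∃ (Greatest Q)
  greatest {P} {q} {Q} wo Q⊆P (𝔪 , 𝔪∈Q) = go 𝔪∈Q (wo (𝔪 , Q⊆P 𝔪∈Q))
    where
    go : ∀ {𝔪} {𝔪∈P : 𝔪 ∈ P} → 𝔪 ∈ Q → Acc (Reverse P) (𝔪 , 𝔪∈P) → ∃ (Greatest Q)
    go {𝔪} 𝔪∈Q (acc rs) with em {P = ∃[ 𝔫 ] (𝔫 ∈ Q × 𝔪 N.≺ 𝔫)}
    ... | yes (𝔫 , 𝔫∈Q , 𝔪≺𝔫) = go 𝔫∈Q (rs {𝔫 , Q⊆P 𝔫∈Q} 𝔪≺𝔫)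
    ... | no  none            = 𝔪 , 𝔪∈Q , λ 𝔫∈Q 𝔪≺𝔫 → none (_ , 𝔫∈Q , 𝔪≺𝔫)

  fromGreatest : ∀ {P : Pred Monomial ℓ} →
                 (∀ {Q : Pred Monomial ℓ} → Q ⊆ P → ∃ Q → ∃ (Greatest Q)) →
                 ReverseWellOrdered P
  fromGreatest {P} hasGreatest x with em {P = Acc (Reverse P) x}
  ... | yes a = a
  ... | no ¬a with hasGreatest {Q} proj₁ (proj₁ x , proj₂ x , ¬a)
    where
    Q : Pred Monomial ℓ
    Q 𝔪 = Σ[ p ∈ P 𝔪 ] ¬ Acc (Reverse P) (𝔪 , p)
  ... | 𝔪 , (p , ¬acc) , max = contradiction (acc rs) ¬acc
    where
    rs : ∀ {y : Σ Monomial P} → 𝔪 N.≺ proj₁ y → Acc (Reverse P) y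
    rs {y} 𝔪≺y with em {P = Acc (Reverse P) y}
    ... | yes a = a
    ... | no ¬a = contradiction 𝔪≺y (max (proj₂ y , ¬a))

  wellBased-⊆ : ∀ {p q} {P : Pred Monomial p} {Q : Pred Monomial q} → P ⊆ Q → WellBased Q → WellBased P
  wellBased-⊆ P⊆Q ((A , f , covers) , wo) =
    (A , f , λ p → covers (P⊆Q p)) ,
    On.wellFounded (map₂ P⊆Q) wo

  wellBased-∪ : ∀ {P Q : Pred Monomial ℓ} → WellBased P → WellBased Q → WellBased (P ∪ Q)
  wellBased-∪ {P} {Q} ((A , f , coversP) , woP) ((B , g , coversQ) , woQ) =
    ((A ⊎ B) , h , covers) , fromGreatest maxima
    where
    h : A ⊎ B → Monomial
    h (inj₁ a) = f a
    h (inj₂ b) = g b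
    covers : ∀ {𝔪} → (P ∪ Q) 𝔪 → ∃[ c ] h c N.≈ 𝔪
    covers (inj₁ p) = inj₁ (proj₁ (coversP p)) , proj₂ (coversP p)
    covers (inj₂ q) = inj₂ (proj₁ (coversQ q)) , proj₂ (coversQ q)
    maxima : ∀ {S : Pred Monomial ℓ} → S ⊆ P ∪ Q → ∃ S → ∃ (Greatest S)
    maxima {S} S⊆ (𝔪 , 𝔪∈S)
      with em {P = ∃[ 𝔫 ] (S 𝔫 × P 𝔫)} | em {P = ∃[ 𝔫 ] (S 𝔫 × Q 𝔫)}
    ... | no ¬p | no ¬q with S⊆ 𝔪∈S
    ...   | inj₁ p = contradiction (𝔪 , 𝔪∈S , p) ¬p
    ...   | inj₂ q = contradiction (𝔪 , 𝔪∈S , q) ¬q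
    maxima {S} S⊆ _ | yes p | no ¬q with greatest {Q = λ 𝔫 → S 𝔫 × P 𝔫} woP proj₂ p
    ...   | 𝔞 , (𝔞∈S , _) , max = 𝔞 , 𝔞∈S , bound
      where
      bound : ∀ {𝔫} → S 𝔫 → 𝔫 N.≼ 𝔞
      bound 𝔫∈S with S⊆ 𝔫∈S
      ... | inj₁ p = max (𝔫∈S , p)
      ... | inj₂ q = contradiction (_ , 𝔫∈S , q) ¬q
    maxima {S} S⊆ _ | no ¬p | yes q with greatest {Q = λ 𝔫 → S 𝔫 × Q 𝔫} woQ proj₂ q
    ...   | 𝔞 , (𝔞∈S , _) , max = 𝔞 , 𝔞∈S , bound
      where
      bound : ∀ {𝔫} → S 𝔫 → 𝔫 N.≼ 𝔞
      bound 𝔫∈S with S⊆ 𝔫∈S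
      ... | inj₁ p = contradiction (_ , 𝔫∈S , p) ¬p
      ... | inj₂ q = max (𝔫∈S , q)
    maxima {S} S⊆ _ | yes p | yes q
      with greatest {Q = λ 𝔫 → S 𝔫 × P 𝔫} woP proj₂ p
         | greatest {Q = λ 𝔫 → S 𝔫 × Q 𝔫} woQ proj₂ q
    ...   | 𝔞 , (𝔞∈S , _) , maxP | 𝔟 , (𝔟∈S , _) , maxQ with N.compare 𝔞 𝔟
    ...     | tri< 𝔞≺𝔟 _ _ = 𝔟 , 𝔟∈S , bound
      where
      bound : ∀ {𝔫} → S 𝔫 → 𝔫 N.≼ 𝔟
      bound 𝔫∈S 𝔟≺𝔫 with S⊆ 𝔫∈S
      ... | inj₁ p = maxP (𝔫∈S , p) (N.≺-trans 𝔞≺𝔟 𝔟≺𝔫)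
      ... | inj₂ q = maxQ (𝔫∈S , q) 𝔟≺𝔫
    ...     | tri≈ _ 𝔞≈𝔟 _ = 𝔟 , 𝔟∈S , bound
      where
      bound : ∀ {𝔫} → S 𝔫 → 𝔫 N.≼ 𝔟
      bound 𝔫∈S 𝔟≺𝔫 with S⊆ 𝔫∈S
      ... | inj₁ p = maxP (𝔫∈S , p) (N.≺-respˡ-≈ (N.sym 𝔞≈𝔟) 𝔟≺𝔫)
      ... | inj₂ q = maxQ (𝔫∈S , q) 𝔟≺𝔫
    ...     | tri> _ _ 𝔟≺𝔞 = 𝔞 , 𝔞∈S , bound
      where
      bound : ∀ {𝔫} → S 𝔫 → 𝔫 N.≼ 𝔞
      bound 𝔫∈S 𝔞≺𝔫 with S⊆ 𝔫∈S
      ... | inj₁ p = maxP (𝔫∈S , p) 𝔞≺𝔫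
      ... | inj₂ q = maxQ (𝔫∈S , q) (N.≺-trans 𝔟≺𝔞 𝔞≺𝔫)

  _⊙_ : Pred Monomial ℓ → Pred Monomial ℓ → Pred Monomial ℓ
  (P ⊙ Q) 𝔪 = ∃[ 𝔞 ] ∃[ 𝔟 ] (P 𝔞 × Q 𝔟 × 𝔞 N.∙ 𝔟 N.≈ 𝔪)

  ∙-monoˡ-≺ : ∀ 𝔠 {𝔞 𝔟} → 𝔞 N.≺ 𝔟 → 𝔞 N.∙ 𝔠 N.≺ 𝔟 N.∙ 𝔠
  ∙-monoˡ-≺ 𝔠 𝔞≺𝔟 =
    N.≺-respˡ-≈ (N.comm 𝔠 _) (N.≺-respʳ-≈ (N.comm 𝔠 _) (N.∙-monoʳ-≺ 𝔠 𝔞≺𝔟))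

  ≼-cases : ∀ {𝔞 𝔟} → 𝔞 N.≼ 𝔟 → 𝔞 N.≺ 𝔟 ⊎ 𝔞 N.≈ 𝔟
  ≼-cases {𝔞} {𝔟} 𝔞≼𝔟 with N.compare 𝔞 𝔟
  ... | tri< p _ _ = inj₁ p
  ... | tri≈ _ p _ = inj₂ p
  ... | tri> _ _ p = contradiction p 𝔞≼𝔟

  ≼≺-trans : ∀ {𝔞 𝔟 𝔠} → 𝔞 N.≼ 𝔟 → 𝔟 N.≺ 𝔠 → 𝔞 N.≺ 𝔠
  ≼≺-trans 𝔞≼𝔟 𝔟≺𝔠 with ≼-cases 𝔞≼𝔟
  ... | inj₁ 𝔞≺𝔟 = N.≺-trans 𝔞≺𝔟 𝔟≺𝔠
  ... | inj₂ 𝔞≈𝔟 = N.≺-respˡ-≈ (N.sym 𝔞≈𝔟) 𝔟≺𝔠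

  ∙-mono-≼ : ∀ {𝔞 𝔟 𝔠 𝔡} → 𝔞 N.≼ 𝔟 → 𝔠 N.≼ 𝔡 → 𝔞 N.∙ 𝔠 N.≼ 𝔟 N.∙ 𝔡
  ∙-mono-≼ {𝔞} {𝔟} {𝔠} {𝔡} 𝔞≼𝔟 𝔠≼𝔡 lt with ≼-cases 𝔞≼𝔟 | ≼-cases 𝔠≼𝔡
  ... | inj₁ p | inj₁ q = N.≺-asym lt (N.≺-trans (∙-monoˡ-≺ 𝔠 p) (N.∙-monoʳ-≺ 𝔟 q))
  ... | inj₁ p | inj₂ q =
    N.≺-asym lt (N.≺-respʳ-≈ (N.∙-congˡ q) (∙-monoˡ-≺ 𝔠 p))
  ... | inj₂ p | inj₁ q =
    N.≺-asym lt (N.≺-respʳ-≈ (N.∙-congʳ p) (N.∙-monoʳ-≺ 𝔞 q))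
  ... | inj₂ p | inj₂ q = N.≺-irrefl (N.sym (N.∙-cong p q)) lt

  wellBased-⊙ : ∀ {P Q : Pred Monomial ℓ} → WellBased P → WellBased Q → WellBased (P ⊙ Q)
  wellBased-⊙ {P} {Q} ((A , f , coversP) , woP) ((B , g , coversQ) , woQ) =
    ((A × B) , (λ (a , b) → f a N.∙ g b) , covers) , fromGreatest maxima
    where
    covers : ∀ {𝔪} → (P ⊙ Q) 𝔪 → ∃[ c ] (f (proj₁ c) N.∙ g (proj₂ c)) N.≈ 𝔪
    covers (𝔞 , 𝔟 , p , q , eq) with coversP p | coversQ q
    ... | a , fa≈𝔞 | b , gb≈𝔟 = (a , b) , N.trans (N.∙-cong fa≈𝔞 gb≈𝔟) eq

    module _ {S : Pred Monomial ℓ} (S⊆ : S ⊆ P ⊙ Q) where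

      -- Second factors 𝔟 of products 𝔞 𝔟 ∈ S with 𝔞 𝔟 ≻ 𝔪.
      Above : Monomial → Pred Monomial ℓ
      Above 𝔪 𝔟 = Q 𝔟 × ∃[ 𝔫 ] ∃[ 𝔞 ] (S 𝔫 × P 𝔞 × 𝔞 N.∙ 𝔟 N.≈ 𝔫 × 𝔪 N.≺ 𝔫)

      climb : ∀ {𝔪 𝔞 𝔟} {p : P 𝔞} → Acc (Reverse P) (𝔞 , p) → S 𝔪 → 𝔞 N.∙ 𝔟 N.≈ 𝔪 →
              (∀ {𝔟′} → Above 𝔪 𝔟′ → 𝔟′ N.≼ 𝔟) → ∃ (Greatest S)
      climb {𝔪} {𝔞} {𝔟} (acc rs) 𝔪∈S 𝔞𝔟≈𝔪 bound with em {P = ∃ (Above 𝔪)}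
      ... | no none = 𝔪 , 𝔪∈S , λ {𝔫} 𝔫∈S 𝔪≺𝔫 →
        let (𝔞′ , 𝔟′ , p , q , eq) = S⊆ 𝔫∈S
        in none (𝔟′ , q , 𝔫 , 𝔞′ , 𝔫∈S , p , eq , 𝔪≺𝔫)
      ... | yes some with greatest {Q = Above 𝔪} woQ proj₁ some
      ...   | 𝔟′ , above@(_ , 𝔫 , 𝔞′ , 𝔫∈S , p′ , eq , 𝔪≺𝔫) , max =
        climb (rs {𝔞′ , p′} 𝔞≺𝔞′) 𝔫∈S eq
          λ (q″ , 𝔫″ , 𝔞″ , s″ , p″ , eq″ , 𝔫≺𝔫″) →
            max (q″ , 𝔫″ , 𝔞″ , s″ , p″ , eq″ , N.≺-trans 𝔪≺𝔫 𝔫≺𝔫″)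
        where
        𝔞≺𝔞′ : 𝔞 N.≺ 𝔞′
        𝔞≺𝔞′ with N.compare 𝔞 𝔞′
        ... | tri< lt _ _ = lt
        ... | tri≈ ¬lt _ _ = contradiction
          (N.≺-respˡ-≈ (N.sym 𝔞𝔟≈𝔪) (N.≺-respʳ-≈ (N.sym eq) 𝔪≺𝔫))
          (∙-mono-≼ ¬lt (bound above))
        ... | tri> ¬lt _ _ = contradiction
          (N.≺-respˡ-≈ (N.sym 𝔞𝔟≈𝔪) (N.≺-respʳ-≈ (N.sym eq) 𝔪≺𝔫))
          (∙-mono-≼ ¬lt (bound above))

      Factor : Pred Monomial ℓ
      Factor 𝔟 = Q 𝔟 × ∃[ 𝔫 ] ∃[ 𝔞 ] (S 𝔫 × P 𝔞 × 𝔞 N.∙ 𝔟 N.≈ 𝔫)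

      maxima : ∃ S → ∃ (Greatest S)
      maxima (𝔪 , 𝔪∈S) with S⊆ 𝔪∈S
      ... | 𝔞 , 𝔟 , p , q , eq
        with greatest {Q = Factor} woQ proj₁ (𝔟 , q , 𝔪 , 𝔞 , 𝔪∈S , p , eq)
      ...   | 𝔟₀ , (q₀ , 𝔫₀ , 𝔞₀ , s₀ , p₀ , eq₀) , max =
        climb (woP (𝔞₀ , p₀)) s₀ eq₀
          λ (q′ , 𝔫′ , 𝔞′ , s′ , p′ , eq′ , _) → max (q′ , 𝔫′ , 𝔞′ , s′ , p′ , eq′)

  module FiniteSums {i j} (I : Setoid i j) where
    open Setoid I using (_≈_; _≉_) renaming (Carrier to Index; refl to ≈-refl; sym to ≈-sym; trans to ≈-trans)
    open ListMembership I using () renaming (_∈_ to _∈ˡ_)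
    open ListUnique I using (Unique)

    -- Classically, containment in a finite list makes P finite; Unique
    -- ensures that a sum over the list counts each index once.
    Finite : ∀ {p} → Pred Index p → Set (i ⊔ j ⊔ p)
    Finite P = Σ[ xs ∈ List Index ] (Unique xs × (∀ {x} → P x → x ∈ˡ xs))

    total : (Index → R.Carrier) → List Index → R.Carrier
    total f = foldr (λ x r → f x R.+ r) R.0#

    total-cong : ∀ {f g} → (∀ x → f x R.≈ g x) → ∀ xs → total f xs R.≈ total g xs
    total-cong f≗g []       = R.refl
    total-cong f≗g (x ∷ xs) = R.+-cong (f≗g x) (total-cong f≗g xs)

    total-zero : ∀ {f} xs → (∀ {x} → x ∈ˡ xs → f x R.≈ R.0#) → total f xs R.≈ R.0#
    total-zero []       _   = R.refl
    total-zero (x ∷ xs) f≈0 =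
      R.trans (R.+-cong (f≈0 (here ≈-refl)) (total-zero xs (λ p → f≈0 (there p))))
              (R.+-identityˡ R.0#)

    total-nonzero : ∀ {f} xs → ¬ (total f xs R.≈ R.0#) → ∃[ x ] ¬ (f x R.≈ R.0#)
    total-nonzero []           ≉0 = contradiction R.refl ≉0
    total-nonzero {f} (x ∷ xs) ≉0 with f x R.≈? R.0#
    ... | no fx≉0  = x , fx≉0
    ... | yes fx≈0 = total-nonzero xs λ ≈0 →
      ≉0 (R.trans (R.+-cong fx≈0 ≈0) (R.+-identityˡ R.0#))

    private
      record Removal (f : Index → R.Carrier) (x : Index) (xs : List Index) : Set (i ⊔ lsuc j ⊔ ℓ) where
        field
          rest     : List Index
          unique   : Unique rest
          splits   : total f xs R.≈ f x R.+ total f rest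
          all-rest : ∀ {P : Pred Index j} → All P xs → All P rest
          member⁻  : ∀ {y} → y ∈ˡ rest → y ∈ˡ xs × y ≉ x
          member⁺  : ∀ {y} → y ∈ˡ xs → y ≉ x → y ∈ˡ rest

      All-∈ : ∀ {P : Pred Index j} → P Respects _≈_ → ∀ {xs x} → All P xs → x ∈ˡ xs → P x
      All-∈ resp (p ∷ _)  (here x≈y)  = resp (≈-sym x≈y) p
      All-∈ resp (_ ∷ ps) (there x∈ys) = All-∈ resp ps x∈ys

      fresh : ∀ {x y xs} → All (x ≉_) xs → y ∈ˡ xs → x ≉ y
      fresh = All-∈ (λ y≈z x≉y x≈z → x≉y (≈-trans x≈z (≈-sym y≈z)))

      remove : ∀ {f : Index → R.Carrier} → (∀ {x y} → x ≈ y → f x R.≈ f y) →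
               ∀ {x} xs → Unique xs → x ∈ˡ xs → Removal f x xs
      remove f-cong (y ∷ ys) (y∉ys ∷ u) (here x≈y) = record
        { rest     = ys
        ; unique   = u
        ; splits   = R.+-congʳ (f-cong (≈-sym x≈y))
        ; all-rest = λ { (_ ∷ ps) → ps }
        ; member⁻  = λ z∈ys → there z∈ys , λ z≈x → fresh y∉ys z∈ys (≈-sym (≈-trans z≈x x≈y))
        ; member⁺  = λ { (here z≈y) z≉x → contradiction (≈-trans z≈y (≈-sym x≈y)) z≉x
                       ; (there z∈ys) _ → z∈ys }
        }
      remove {f} f-cong {x} (y ∷ ys) (y∉ys ∷ u) (there x∈ys) = record
        { rest     = y ∷ rest
        ; unique   = all-rest y∉ys ∷ unique
        ; splits   = R.trans (R.+-congˡ splits)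
                       (R.trans (R.sym (R.+-assoc _ _ _))
                         (R.trans (R.+-congʳ (R.+-comm _ _)) (R.+-assoc _ _ _)))
        ; all-rest = λ { (p ∷ ps) → p ∷ all-rest ps }
        ; member⁻  = λ { (here z≈y) → here z≈y ,
                           λ z≈x → fresh y∉ys x∈ys (≈-trans (≈-sym z≈y) z≈x)
                       ; (there z∈) → there (proj₁ (member⁻ z∈)) , proj₂ (member⁻ z∈) }
        ; member⁺  = λ { (here z≈y) _ → here z≈y
                       ; (there z∈ys) z≉x → there (member⁺ z∈ys z≉x) }
        }
        where open Removal (remove f-cong ys u x∈ys)

    total-unique : ∀ {f : Index → R.Carrier} → (∀ {x y} → x ≈ y → f x R.≈ f y) →
                   ∀ {xs ys} → Unique xs → Unique ys →
                   (∀ {x} → ¬ (f x R.≈ R.0#) → x ∈ˡ xs → x ∈ˡ ys) →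
                   (∀ {x} → ¬ (f x R.≈ R.0#) → x ∈ˡ ys → x ∈ˡ xs) →
                   total f xs R.≈ total f ys
    total-unique {f} f-cong {[]} {ys} _ _ _ ys⊆xs = R.sym (total-zero ys vanish)
      where
      vanish : ∀ {x} → x ∈ˡ ys → f x R.≈ R.0#
      vanish {x} x∈ys with f x R.≈? R.0#
      ... | yes fx≈0 = fx≈0
      ... | no fx≉0 with () ← ys⊆xs fx≉0 x∈ys
    total-unique {f} f-cong {x ∷ xs} {ys} (x∉xs ∷ u) v xs⊆ys ys⊆xs with f x R.≈? R.0#
    ... | yes fx≈0 = R.trans (R.+-congʳ fx≈0) (R.trans (R.+-identityˡ _)
      (total-unique f-cong u v (λ fy≉0 y∈xs → xs⊆ys fy≉0 (there y∈xs)) back))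
      where
      back : ∀ {y} → ¬ (f y R.≈ R.0#) → y ∈ˡ ys → y ∈ˡ xs
      back fy≉0 y∈ys with ys⊆xs fy≉0 y∈ys
      ... | here y≈x   = contradiction (R.trans (f-cong y≈x) fx≈0) fy≉0
      ... | there y∈xs = y∈xs
    ... | no fx≉0 = R.trans (R.+-congˡ (total-unique f-cong u unique forth back)) (R.sym splits)
      where
      open Removal (remove f-cong ys v (xs⊆ys fx≉0 (here ≈-refl)))
      forth : ∀ {y} → ¬ (f y R.≈ R.0#) → y ∈ˡ xs → y ∈ˡ rest
      forth fy≉0 y∈xs = member⁺ (xs⊆ys fy≉0 (there y∈xs)) (λ y≈x → fresh x∉xs y∈xs (≈-sym y≈x))
      back : ∀ {y} → ¬ (f y R.≈ R.0#) → y ∈ˡ rest → y ∈ˡ xs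
      back fy≉0 y∈rest with ys⊆xs fy≉0 (proj₁ (member⁻ y∈rest))
      ... | here y≈x   = contradiction y≈x (proj₂ (member⁻ y∈rest))
      ... | there y∈xs = y∈xs

    Support : (Index → R.Carrier) → Pred Index ℓ
    Support f x = ¬ (f x R.≈ R.0#)

    sumOver : ∀ {p} {P : Pred Index p} → Finite P → (Index → R.Carrier) → R.Carrier
    sumOver fin f = total f (proj₁ fin)

    sumOver-cong : ∀ {p q} {P : Pred Index p} {Q : Pred Index q} (fin : Finite P) (fin′ : Finite Q)
             {f g : Index → R.Carrier} → (∀ {x y} → x ≈ y → f x R.≈ f y) →
             (∀ x → f x R.≈ g x) → Support f ⊆ P → Support g ⊆ Q →
             sumOver fin f R.≈ sumOver fin′ g
    sumOver-cong (xs , u , covers) (ys , v , covers′) f-cong f≗g ⊆P ⊆Q =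
      R.trans
        (total-unique f-cong u v
          (λ fx≉0 _ → covers′ (⊆Q λ gx≈0 → fx≉0 (R.trans (f≗g _) gx≈0)))
          (λ fx≉0 _ → covers (⊆P fx≉0)))
        (total-cong f≗g ys)

  module _ {P A : Pred Monomial ℓ} (wo : ReverseWellOrdered P) (A⊆P : A ⊆ P)
           (least : ∀ {Q : Pred Monomial ℓ} → Q ⊆ A → ∃ Q →
                    ∃[ 𝔪 ] (Q 𝔪 × (∀ {𝔫} → Q 𝔫 → 𝔪 N.≼ 𝔫))) where
    open FiniteSums N.setoid
    open ListMembership N.setoid using () renaming (_∈_ to _∈ˡ_)
    open ListUnique N.setoid using (Unique)

    private
      Segment : Monomial → Set ℓ
      Segment 𝔞 = Σ[ xs ∈ List Monomial ]
        (Unique xs × All (𝔞 N.≼_) xs × (∀ {𝔟} → A 𝔟 → 𝔞 N.≼ 𝔟 → 𝔟 ∈ˡ xs))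

      segment : ∀ {𝔞} {p : P 𝔞} → Acc (Reverse P) (𝔞 , p) → A 𝔞 → Segment 𝔞
      segment {𝔞} (acc rs) 𝔞∈A with em {P = ∃[ 𝔟 ] (A 𝔟 × 𝔞 N.≺ 𝔟)}
      ... | no none =
        𝔞 ∷ [] , [] ∷ [] , N.≺-irrefl N.refl ∷ [] , covers
        where
        covers : ∀ {𝔟} → A 𝔟 → 𝔞 N.≼ 𝔟 → 𝔟 ∈ˡ (𝔞 ∷ [])
        covers 𝔟∈A 𝔞≼𝔟 with ≼-cases 𝔞≼𝔟
        ... | inj₁ 𝔞≺𝔟 = contradiction (_ , 𝔟∈A , 𝔞≺𝔟) none
        ... | inj₂ 𝔞≈𝔟 = here (N.sym 𝔞≈𝔟)
      ... | yes some with least {Q = λ 𝔟 → A 𝔟 × 𝔞 N.≺ 𝔟} proj₁ some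
      ...   | 𝔟 , (𝔟∈A , 𝔞≺𝔟) , min with segment (rs {𝔟 , A⊆P 𝔟∈A} 𝔞≺𝔟) 𝔟∈A
      ...     | xs , u , lower , covers =
        𝔞 ∷ xs , All.map apart lower ∷ u ,
        N.≺-irrefl N.refl ∷ All.map below lower , covers′
        where
        apart : ∀ {𝔠} → 𝔟 N.≼ 𝔠 → ¬ (𝔞 N.≈ 𝔠)
        apart 𝔟≼𝔠 𝔞≈𝔠 = 𝔟≼𝔠 (N.≺-respˡ-≈ 𝔞≈𝔠 𝔞≺𝔟)
        below : ∀ {𝔠} → 𝔟 N.≼ 𝔠 → 𝔞 N.≼ 𝔠
        below 𝔟≼𝔠 𝔠≺𝔞 = 𝔟≼𝔠 (N.≺-trans 𝔠≺𝔞 𝔞≺𝔟)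
        covers′ : ∀ {𝔠} → A 𝔠 → 𝔞 N.≼ 𝔠 → 𝔠 ∈ˡ (𝔞 ∷ xs)
        covers′ 𝔠∈A 𝔞≼𝔠 with ≼-cases 𝔞≼𝔠
        ... | inj₁ 𝔞≺𝔠 = there (covers 𝔠∈A (min (𝔠∈A , 𝔞≺𝔠)))
        ... | inj₂ 𝔞≈𝔠 = here (N.sym 𝔞≈𝔠)

    doublyWellOrdered⇒finite : Finite A
    doublyWellOrdered⇒finite with em {P = ∃ A}
    ... | no none = [] , [] , λ 𝔞∈A → contradiction (_ , 𝔞∈A) none
    ... | yes some with least (λ 𝔞∈A → 𝔞∈A) some
    ...   | 𝔞 , 𝔞∈A , min with segment (wo (𝔞 , A⊆P 𝔞∈A)) 𝔞∈A
    ...     | xs , u , _ , covers = xs , u , λ 𝔟∈A → covers 𝔟∈A (min 𝔟∈A)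

  record Series : Set (lsuc κ ⊔ ℓ) where
    no-eta-equality
    field
      coeff      : Monomial → R.Carrier
      coeff-cong : ∀ {𝔪 𝔫} → 𝔪 N.≈ 𝔫 → coeff 𝔪 R.≈ coeff 𝔫
      wellBased  : WellBased (λ 𝔪 → ¬ (coeff 𝔪 R.≈ R.0#))

  open Series public

  infix  4 _≈_ _≉_
  infixl 6 _+_ _-_
  infixl 7 _*_ _•_
  infix  8 -_
  infixr 9 _^_

  supp : Series → Pred Monomial ℓ
  supp s 𝔪 = ¬ (coeff s 𝔪 R.≈ R.0#)

  record _≈_ (s t : Series) : Set ℓ where
    constructor pointwise
    field
      at : ∀ 𝔪 → coeff s 𝔪 R.≈ coeff t 𝔪

  open _≈_ public

  _≉_ : Rel Series ℓ
  s ≉ t = ¬ (s ≈ t)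

  ≈-setoid : Setoid (lsuc κ ⊔ ℓ) ℓ
  ≈-setoid = record
    { Carrier = Series
    ; _≈_     = _≈_
    ; isEquivalence = record
      { refl  = pointwise λ _ → R.refl
      ; sym   = λ eq → pointwise λ 𝔪 → R.sym (at eq 𝔪)
      ; trans = λ eq eq′ → pointwise λ 𝔪 → R.trans (at eq 𝔪) (at eq′ 𝔪)
      }
    }

  module ≈ = Setoid ≈-setoid

  supp-resp-≈ : ∀ {s t} → s ≈ t → supp s ⊆ supp t
  supp-resp-≈ s≈t ≉0 ≈0 = ≉0 (R.trans (at s≈t _) ≈0)

  supp-resp : ∀ s {𝔪 𝔫} → 𝔪 N.≈ 𝔫 → supp s 𝔪 → supp s 𝔫
  supp-resp s 𝔪≈𝔫 ≉0 ≈0 = ≉0 (R.trans (coeff-cong s 𝔪≈𝔫) ≈0)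

  singleton-wellBased : ∀ 𝔪 → WellBased (N._≈ 𝔪)
  singleton-wellBased 𝔪 =
    (⊤ , (λ _ → 𝔪) , λ 𝔫≈𝔪 → tt , N.sym 𝔫≈𝔪) ,
    λ (𝔫 , 𝔫≈𝔪) → acc λ { {𝔫′ , 𝔫′≈𝔪} 𝔫≺𝔫′ →
      contradiction 𝔫≺𝔫′ (N.≺-irrefl (N.trans 𝔫≈𝔪 (N.sym 𝔫′≈𝔪))) }

  indicator : ∀ {𝔪 𝔫} → Dec (𝔫 N.≈ 𝔪) → R.Carrier
  indicator (yes _) = R.1#
  indicator (no _)  = R.0#

  indicator-yes : ∀ {𝔪 𝔫} → 𝔫 N.≈ 𝔪 → (d : Dec (𝔫 N.≈ 𝔪)) → indicator d R.≈ R.1#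
  indicator-yes _ (yes _) = R.refl
  indicator-yes p (no ¬p) = contradiction p ¬p

  indicator-supp : ∀ {𝔪 𝔫} (d : Dec (𝔫 N.≈ 𝔪)) → ¬ (indicator d R.≈ R.0#) → 𝔫 N.≈ 𝔪
  indicator-supp (yes p) _  = p
  indicator-supp (no _)  ≉0 = contradiction R.refl ≉0

  indicator-cong : ∀ {𝔪 𝔫 𝔪′ 𝔫′} → 𝔪 N.≈ 𝔪′ → 𝔫 N.≈ 𝔫′ →
                   (d : Dec (𝔫 N.≈ 𝔪)) (d′ : Dec (𝔫′ N.≈ 𝔪′)) → indicator d R.≈ indicator d′
  indicator-cong _ _ (yes _) (yes _) = R.refl
  indicator-cong _ _ (no _)  (no _)  = R.refl
  indicator-cong e f (yes p) (no ¬p) =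
    contradiction (N.trans (N.sym f) (N.trans p e)) ¬p
  indicator-cong e f (no ¬p) (yes p) =
    contradiction (N.trans f (N.trans p (N.sym e))) ¬p

  mono : Monomial → Series
  mono 𝔪 .coeff 𝔫                   = indicator (𝔫 N.≈? 𝔪)
  mono 𝔪 .coeff-cong {𝔫} {𝔫′} 𝔫≈𝔫′ = indicator-cong N.refl 𝔫≈𝔫′ (𝔫 N.≈? 𝔪) (𝔫′ N.≈? 𝔪)
  mono 𝔪 .wellBased                 =
    wellBased-⊆ (λ {𝔫} → indicator-supp (𝔫 N.≈? 𝔪)) (singleton-wellBased 𝔪)

  0ˢ : Series
  0ˢ .coeff _      = R.0#
  0ˢ .coeff-cong _ = R.refl
  0ˢ .wellBased    = wellBased-⊆ (λ ≉0 → contradiction R.refl ≉0) (singleton-wellBased N.ε)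

  1ˢ : Series
  1ˢ = mono N.ε

  _•_ : R.Carrier → Series → Series
  (r • s) .coeff 𝔪        = r R.* coeff s 𝔪
  (r • s) .coeff-cong 𝔪≈𝔫 = R.*-congˡ (coeff-cong s 𝔪≈𝔫)
  (r • s) .wellBased      =
    wellBased-⊆ (λ ≉0 ≈0 → ≉0 (R.trans (R.*-congˡ ≈0) (R.zeroʳ r))) (wellBased s)

  const : R.Carrier → Series
  const r = r • 1ˢ

  +-supp : ∀ s t {𝔪} → ¬ (coeff s 𝔪 R.+ coeff t 𝔪 R.≈ R.0#) → (supp s ∪ supp t) 𝔪
  +-supp s t {𝔪} ≉0 with coeff s 𝔪 R.≈? R.0#
  ... | no s≉0  = inj₁ s≉0
  ... | yes s≈0 = inj₂ λ t≈0 → ≉0 (R.trans (R.+-cong s≈0 t≈0) (R.+-identityˡ R.0#))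

  _+_ : Series → Series → Series
  (s + t) .coeff 𝔪        = coeff s 𝔪 R.+ coeff t 𝔪
  (s + t) .coeff-cong 𝔪≈𝔫 = R.+-cong (coeff-cong s 𝔪≈𝔫) (coeff-cong t 𝔪≈𝔫)
  (s + t) .wellBased      =
    wellBased-⊆ (+-supp s t) (wellBased-∪ (wellBased s) (wellBased t))

  -_ : Series → Series
  (- s) .coeff 𝔪        = R.- coeff s 𝔪
  (- s) .coeff-cong 𝔪≈𝔫 = R.-‿cong (coeff-cong s 𝔪≈𝔫)
  (- s) .wellBased      =
    wellBased-⊆ (λ ≉0 ≈0 → ≉0 (R.trans (R.-‿cong ≈0) R.-0#≈0#)) (wellBased s)

  _-_ : Series → Series → Series
  s - t = s + (- t)

  -- The contribution s(𝔞) t(𝔟), with 𝔞 𝔟 = 𝔪, to the Cauchy product.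
  cauchyTerm : Series → Series → Monomial → Monomial → R.Carrier
  cauchyTerm s t 𝔪 𝔞 = coeff s 𝔞 R.* coeff t (𝔞 N.⁻¹ N.∙ 𝔪)

  cauchyTerm-cong : ∀ s t {𝔪 𝔫 𝔞 𝔟} → 𝔪 N.≈ 𝔫 → 𝔞 N.≈ 𝔟 →
                    cauchyTerm s t 𝔪 𝔞 R.≈ cauchyTerm s t 𝔫 𝔟
  cauchyTerm-cong s t 𝔪≈𝔫 𝔞≈𝔟 =
    R.*-cong (coeff-cong s 𝔞≈𝔟) (coeff-cong t (N.∙-cong (N.⁻¹-cong 𝔞≈𝔟) 𝔪≈𝔫))

  module Sums = FiniteSums N.setoid

  cancelˡ : ∀ 𝔞 𝔪 → 𝔞 N.∙ (𝔞 N.⁻¹ N.∙ 𝔪) N.≈ 𝔪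
  cancelˡ 𝔞 𝔪 = N.trans (N.sym (N.assoc _ _ _))
                  (N.trans (N.∙-congʳ (N.inverseʳ 𝔞)) (N.identityˡ 𝔪))

  cancelˡ′ : ∀ 𝔞 𝔪 → 𝔞 N.⁻¹ N.∙ (𝔞 N.∙ 𝔪) N.≈ 𝔪
  cancelˡ′ 𝔞 𝔪 = N.trans (N.sym (N.assoc _ _ _))
                   (N.trans (N.∙-congʳ (N.inverseˡ 𝔞)) (N.identityˡ 𝔪))

  module _ (s t : Series) where

    cauchyTerm-supp : ∀ {𝔪 𝔞} → ¬ (cauchyTerm s t 𝔪 𝔞 R.≈ R.0#) →
                      supp s 𝔞 × supp t (𝔞 N.⁻¹ N.∙ 𝔪)
    cauchyTerm-supp ≉0 =
      (λ ≈0 → ≉0 (R.trans (R.*-congʳ ≈0) (R.zeroˡ _))) ,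
      (λ ≈0 → ≉0 (R.trans (R.*-congˡ ≈0) (R.zeroʳ _)))

    cauchyFinite : ∀ 𝔪 → Sums.Finite (Sums.Support (cauchyTerm s t 𝔪))
    cauchyFinite 𝔪 = doublyWellOrdered⇒finite (proj₂ (wellBased s))
      (λ ≉0 → proj₁ (cauchyTerm-supp ≉0)) least
      where
      least : ∀ {Q : Pred Monomial ℓ} → Q ⊆ Sums.Support (cauchyTerm s t 𝔪) → ∃ Q →
              ∃[ 𝔞 ] (Q 𝔞 × (∀ {𝔟} → Q 𝔟 → 𝔞 N.≼ 𝔟))
      least {Q} Q⊆ (𝔠 , 𝔠∈Q)
        with greatest {Q = λ 𝔟 → ∃[ 𝔞 ] (Q 𝔞 × 𝔞 N.⁻¹ N.∙ 𝔪 N.≈ 𝔟)} (proj₂ (wellBased t))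
               (λ (𝔞 , 𝔞∈Q , eq) → supp-resp t eq (proj₂ (cauchyTerm-supp (Q⊆ 𝔞∈Q))))
               (_ , 𝔠 , 𝔠∈Q , N.refl)
      ... | 𝔟 , (𝔞 , 𝔞∈Q , eq) , max = 𝔞 , 𝔞∈Q , λ {𝔞′} 𝔞′∈Q 𝔞′≺𝔞 →
        max (𝔞′ , 𝔞′∈Q , N.refl)
          (N.≺-respˡ-≈ eq (N.≺-respˡ-≈ (swap 𝔞′ 𝔞) (N.≺-respʳ-≈ (swap′ 𝔞′ 𝔞)
            (∙-monoˡ-≺ (𝔞′ N.⁻¹ N.∙ (𝔞 N.⁻¹ N.∙ 𝔪)) 𝔞′≺𝔞))))
        where
        swap : ∀ 𝔞′ 𝔞 → 𝔞′ N.∙ (𝔞′ N.⁻¹ N.∙ (𝔞 N.⁻¹ N.∙ 𝔪)) N.≈ 𝔞 N.⁻¹ N.∙ 𝔪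
        swap 𝔞′ 𝔞 = cancelˡ 𝔞′ _
        swap′ : ∀ 𝔞′ 𝔞 → 𝔞 N.∙ (𝔞′ N.⁻¹ N.∙ (𝔞 N.⁻¹ N.∙ 𝔪)) N.≈ 𝔞′ N.⁻¹ N.∙ 𝔪
        swap′ 𝔞′ 𝔞 =
          N.trans (N.∙-congˡ (N.trans (N.sym (N.assoc _ _ _))
                    (N.trans (N.∙-congʳ (N.comm _ _)) (N.assoc _ _ _)))) (cancelˡ 𝔞 _)

  cauchySum : Series → Series → Monomial → R.Carrier
  cauchySum s t 𝔪 = Sums.sumOver (cauchyFinite s t 𝔪) (cauchyTerm s t 𝔪)

  cauchySum-cong : ∀ s t {𝔪 𝔫} → 𝔪 N.≈ 𝔫 → cauchySum s t 𝔪 R.≈ cauchySum s t 𝔫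
  cauchySum-cong s t {𝔪} {𝔫} 𝔪≈𝔫 =
    Sums.sumOver-cong {P = Sums.Support (cauchyTerm s t 𝔪)} {Q = Sums.Support (cauchyTerm s t 𝔫)}
      (cauchyFinite s t 𝔪) (cauchyFinite s t 𝔫)
      (cauchyTerm-cong s t N.refl) (λ _ → cauchyTerm-cong s t 𝔪≈𝔫 N.refl) (λ p → p) (λ p → p)

  cauchySum-supp : ∀ s t {𝔪} → ¬ (cauchySum s t 𝔪 R.≈ R.0#) → (supp s ⊙ supp t) 𝔪
  cauchySum-supp s t {𝔪} ≉0 with Sums.total-nonzero (proj₁ (cauchyFinite s t 𝔪)) ≉0
  ... | 𝔞 , term≉0 with cauchyTerm-supp s t term≉0
  ...   | 𝔞∈s , 𝔟∈t = 𝔞 , _ , 𝔞∈s , 𝔟∈t , cancelˡ 𝔞 𝔪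

  _*_ : Series → Series → Series
  (s * t) .coeff          = cauchySum s t
  (s * t) .coeff-cong     = cauchySum-cong s t
  (s * t) .wellBased      =
    wellBased-⊆ (cauchySum-supp s t) (wellBased-⊙ (wellBased s) (wellBased t))

  _^_ : Series → ℕ → Series
  s ^ zero  = 1ˢ
  s ^ suc k = s * s ^ k

  mono-cong : ∀ {𝔪 𝔫} → 𝔪 N.≈ 𝔫 → mono 𝔪 ≈ mono 𝔫
  mono-cong {𝔪} {𝔫} 𝔪≈𝔫 =
    pointwise λ 𝔞 → indicator-cong 𝔪≈𝔫 N.refl (𝔞 N.≈? 𝔪) (𝔞 N.≈? 𝔫)

  •-cong : ∀ r {s t} → s ≈ t → r • s ≈ r • t
  •-cong r s≈t = pointwise λ 𝔪 → R.*-congˡ (at s≈t 𝔪)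

  +-cong : ∀ {s s′ t t′} → s ≈ s′ → t ≈ t′ → s + t ≈ s′ + t′
  +-cong s≈s′ t≈t′ = pointwise λ 𝔪 → R.+-cong (at s≈s′ 𝔪) (at t≈t′ 𝔪)

  -‿cong : ∀ {s t} → s ≈ t → - s ≈ - t
  -‿cong s≈t = pointwise λ 𝔪 → R.-‿cong (at s≈t 𝔪)

  *-cong : ∀ {s s′ t t′} → s ≈ s′ → t ≈ t′ → s * t ≈ s′ * t′
  *-cong {s} {s′} {t} {t′} s≈s′ t≈t′ = pointwise λ 𝔪 →
    Sums.sumOver-cong {P = Sums.Support (cauchyTerm s t 𝔪)} {Q = Sums.Support (cauchyTerm s′ t′ 𝔪)}
      (cauchyFinite s t 𝔪) (cauchyFinite s′ t′ 𝔪)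
      (cauchyTerm-cong s t N.refl) (λ 𝔞 → R.*-cong (at s≈s′ 𝔞) (at t≈t′ _))
      (λ p → p) (λ p → p)

  ^-cong : ∀ k {s t} → s ≈ t → s ^ k ≈ t ^ k
  ^-cong zero    _   = ≈.refl
  ^-cong (suc k) s≈t = *-cong s≈t (^-cong k s≈t)

  Dominant : Series → Pred Monomial ℓ
  Dominant s = Greatest (supp s)

  dominant : ∀ {s} → s ≉ 0ˢ → ∃ (Dominant s)
  dominant {s} s≉0 with em {P = ∃ (supp s)}
  ... | yes some = greatest (proj₂ (wellBased s)) (λ p → p) some
  ... | no none  = contradiction (pointwise zero-everywhere) s≉0
    where
    zero-everywhere : ∀ 𝔪 → coeff s 𝔪 R.≈ R.0#
    zero-everywhere 𝔪 with coeff s 𝔪 R.≈? R.0#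
    ... | yes ≈0 = ≈0
    ... | no ≉0  = contradiction (𝔪 , ≉0) none

  record Positive (s : Series) : Set ℓ where
    constructor positive
    field
      {monomial}  : Monomial
      isDominant  : Dominant s monomial
      coeff>0     : R.0# R.< coeff s monomial

  infix 4 _<_ _≤_

  _<_ _≤_ : Rel Series ℓ
  s < t = Positive (t - s)
  s ≤ t = s < t ⊎ s ≈ t

  positive-resp-≈ : ∀ {s t} → s ≈ t → Positive s → Positive t
  positive-resp-≈ s≈t (positive (𝔪∈s , max) 0<) = positive
    (supp-resp-≈ s≈t 𝔪∈s , λ 𝔫∈t → max (supp-resp-≈ (≈.sym s≈t) 𝔫∈t))
    (R.<-respʳ-≈ (at s≈t _) 0<)

  positive⇒≉0 : ∀ {s} → Positive s → s ≉ 0ˢ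
  positive⇒≉0 (positive (𝔪∈s , _) _) s≈0 = 𝔪∈s (at s≈0 _)

  ≉0⇒positive⊎negative : ∀ {s} → s ≉ 0ˢ → Positive s ⊎ Positive (- s)
  ≉0⇒positive⊎negative {s} s≉0 with dominant s≉0
  ... | 𝔪 , 𝔪∈s , max with R.compare R.0# (coeff s 𝔪)
  ...   | tri< 0< _ _ = inj₁ (positive (𝔪∈s , max) 0<)
  ...   | tri≈ _ ≈0 _ = contradiction (R.sym ≈0) 𝔪∈s
  ...   | tri> _ _ <0 = inj₂ (positive
    (R.pos⇒≉0 (R.neg⇒-pos <0) , λ ≉0 → max (λ ≈0 → ≉0 (R.trans (R.-‿cong ≈0) R.-0#≈0#)))
    (R.neg⇒-pos <0))

  outside : ∀ s {𝔪 𝔫} → Dominant s 𝔪 → 𝔪 N.≺ 𝔫 → coeff s 𝔫 R.≈ R.0#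
  outside s {𝔫 = 𝔫} (_ , max) 𝔪≺𝔫 with coeff s 𝔫 R.≈? R.0#
  ... | yes ≈0 = ≈0
  ... | no ≉0  = contradiction 𝔪≺𝔫 (max ≉0)

  positive-+ : ∀ {s t} → Positive s → Positive t → Positive (s + t)
  positive-+ {s} {t} (positive {𝔞} d 0<a) (positive {𝔟} e 0<b) with N.compare 𝔞 𝔟
  ... | tri< 𝔞≺𝔟 _ _ =
    positive (R.pos⇒≉0 0<ab , bound) 0<ab
    where
    0<ab = R.<-respʳ-≈ (R.sym (R.trans (R.+-congʳ (outside s d 𝔞≺𝔟)) (R.+-identityˡ _))) 0<b
    bound : ∀ {𝔫} → supp (s + t) 𝔫 → 𝔫 N.≼ 𝔟
    bound ≉0 𝔟≺𝔫 = ≉0 (R.trans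
      (R.+-cong (outside s d (N.≺-trans 𝔞≺𝔟 𝔟≺𝔫)) (outside t e 𝔟≺𝔫)) (R.+-identityˡ R.0#))
  ... | tri≈ _ 𝔞≈𝔟 _ =
    positive (R.pos⇒≉0 0<ab , bound) 0<ab
    where
    0<ab = R.+-pos (R.<-respʳ-≈ (coeff-cong s 𝔞≈𝔟) 0<a) 0<b
    bound : ∀ {𝔫} → supp (s + t) 𝔫 → 𝔫 N.≼ 𝔟
    bound ≉0 𝔟≺𝔫 = ≉0 (R.trans
      (R.+-cong (outside s d (N.≺-respˡ-≈ (N.sym 𝔞≈𝔟) 𝔟≺𝔫)) (outside t e 𝔟≺𝔫))
      (R.+-identityˡ R.0#))
  ... | tri> _ _ 𝔟≺𝔞 =
    positive (R.pos⇒≉0 0<ab , bound) 0<ab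
    where
    0<ab = R.<-respʳ-≈ (R.sym (R.trans (R.+-congˡ (outside t e 𝔟≺𝔞)) (R.+-identityʳ _))) 0<a
    bound : ∀ {𝔫} → supp (s + t) 𝔫 → 𝔫 N.≼ 𝔞
    bound ≉0 𝔞≺𝔫 = ≉0 (R.trans
      (R.+-cong (outside s d 𝔞≺𝔫) (outside t e (N.≺-trans 𝔟≺𝔞 𝔞≺𝔫))) (R.+-identityˡ R.0#))

  positive-double⁻ : ∀ {s} → Positive (s + s) → Positive s
  positive-double⁻ {s} pos with em {P = s ≈ 0ˢ}
  ... | yes s≈0 = contradiction
    (≈.trans (+-cong s≈0 s≈0) (pointwise λ _ → R.+-identityˡ R.0#)) (positive⇒≉0 pos)
  ... | no s≉0 with ≉0⇒positive⊎negative s≉0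
  ...   | inj₁ p = p
  ...   | inj₂ n = contradiction
    (pointwise λ 𝔪 → R.trans (R.+-congˡ (R.-‿+-comm _ _)) (R.-‿inverseʳ _))
    (positive⇒≉0 (positive-+ pos (positive-+ n n)))

  positive-* : ∀ {s t} → Positive s → Positive t → Positive (s * t)
  positive-* {s} {t} (positive {𝔞} (𝔞∈s , maxˢ) 0<a) (positive {𝔟} (𝔟∈t , maxᵗ) 0<b) =
    positive (R.pos⇒≉0 0<ab , bound) 0<ab
    where
    only : Sums.Finite (N._≈ 𝔞)
    only = 𝔞 ∷ [] , [] ∷ [] , here
    unique : Sums.Support (cauchyTerm s t (𝔞 N.∙ 𝔟)) ⊆ (N._≈ 𝔞)
    unique {𝔠} ≉0 with cauchyTerm-supp s t ≉0
    ... | 𝔠∈s , 𝔡∈t with ≼-cases (maxˢ 𝔠∈s)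
    ...   | inj₂ 𝔠≈𝔞 = 𝔠≈𝔞
    ...   | inj₁ 𝔠≺𝔞 = contradiction
      (N.≺-respʳ-≈ (N.sym (cancelˡ 𝔠 (𝔞 N.∙ 𝔟))) (∙-monoˡ-≺ 𝔟 𝔠≺𝔞))
      (∙-mono-≼ (N.≺-irrefl N.refl) (maxᵗ 𝔡∈t))
    product : coeff (s * t) (𝔞 N.∙ 𝔟) R.≈ coeff s 𝔞 R.* coeff t 𝔟
    product = R.trans
      (Sums.sumOver-cong {P = Sums.Support (cauchyTerm s t (𝔞 N.∙ 𝔟))} {Q = N._≈ 𝔞}
        (cauchyFinite s t (𝔞 N.∙ 𝔟)) only
        (cauchyTerm-cong s t N.refl) (λ _ → R.refl) (λ p → p) unique)
      (R.trans (R.+-identityʳ _) (R.*-congˡ (coeff-cong t (cancelˡ′ 𝔞 𝔟))))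
    0<ab = R.<-respʳ-≈ (R.sym product) (R.*-pos 0<a 0<b)
    bound : ∀ {𝔫} → supp (s * t) 𝔫 → 𝔫 N.≼ 𝔞 N.∙ 𝔟
    bound 𝔫∈st with cauchySum-supp s t 𝔫∈st
    ... | 𝔠 , 𝔡 , 𝔠∈s , 𝔡∈t , eq = λ lt →
      ∙-mono-≼ (maxˢ 𝔠∈s) (maxᵗ 𝔡∈t) (N.≺-respʳ-≈ (N.sym eq) lt)

  mono-positive : ∀ 𝔪 → Positive (mono 𝔪)
  mono-positive 𝔪 = positive (R.pos⇒≉0 0<m , bound) 0<m
    where
    0<m = R.<-respʳ-≈ (R.sym (indicator-yes N.refl (𝔪 N.≈? 𝔪))) R.0<1
    bound : ∀ {𝔫} → supp (mono 𝔪) 𝔫 → 𝔫 N.≼ 𝔪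
    bound {𝔫} 𝔫∈ = N.≺-irrefl (N.sym (indicator-supp (𝔫 N.≈? 𝔪) 𝔫∈))

  mono≉0 : ∀ 𝔪 → mono 𝔪 ≉ 0ˢ
  mono≉0 𝔪 = positive⇒≉0 (mono-positive 𝔪)

  ∣_∣ : Series → Series
  ∣ s ∣ with em {P = Positive s}
  ... | yes _ = s
  ... | no  _ = - s

  ∣∣-positive : ∀ {s} → s ≉ 0ˢ → Positive ∣ s ∣
  ∣∣-positive {s} s≉0 with em {P = Positive s} | ≉0⇒positive⊎negative s≉0
  ... | yes p | _      = p
  ... | no _  | inj₂ n = n
  ... | no ¬p | inj₁ p = contradiction p ¬p

  infix 4 _≺_ _≼_

  _≺_ _≼_ : Rel Series ℓ
  s ≺ t = ∀ r → R.0# R.< r → r • ∣ s ∣ < ∣ t ∣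
  s ≼ t = ¬ (t ≺ s)

  ∣∣-identity : ∀ {s} → Positive s → ∣ s ∣ ≈ s
  ∣∣-identity {s} pos with em {P = Positive s}
  ... | yes _   = ≈.refl
  ... | no ¬pos = contradiction pos ¬pos

  positive⊎∣∣-neg : ∀ s → Positive s ⊎ ∣ s ∣ ≈ - s
  positive⊎∣∣-neg s with em {P = Positive s}
  ... | yes pos = inj₁ pos
  ... | no _    = inj₂ ≈.refl

  const-positive : ∀ {r} → R.0# R.< r → Positive (const r)
  const-positive {r} 0<r with mono-positive N.ε
  ... | positive {𝔪} (_ , max) 0<1 = positive
    (R.pos⇒≉0 0<r1 , λ ≉0 → max λ ≈0 → ≉0 (R.trans (R.*-congˡ ≈0) (R.zeroʳ r))) 0<r1
    where
    0<r1 : R.0# R.< coeff (const r) 𝔪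
    0<r1 = R.*-pos 0<r 0<1

  -0-identity : ∀ s → s - 0ˢ ≈ s
  -0-identity s = pointwise λ 𝔪 →
    R.trans (R.+-congˡ R.-0#≈0#) (R.+-identityʳ _)

  const-0 : const R.0# ≈ 0ˢ
  const-0 = pointwise λ 𝔪 → R.zeroˡ _

  -- s ∈ 𝕋^{>,≻}
  Infinite : Pred Series ℓ
  Infinite s = ∀ r → const r < s

  infinite⇒positive : ∀ {s} → Infinite s → Positive s
  infinite⇒positive {s} inf = positive-resp-≈
    (≈.trans (+-cong ≈.refl (-‿cong const-0)) (-0-identity s)) (inf R.0#)

  positive-+-≺ : ∀ {s δ} → Positive s → δ ≺ s → Positive (s + δ)
  positive-+-≺ {s} {δ} s>0 δ≺s with positive⊎∣∣-neg δ
  ... | inj₁ δ>0 = positive-+ s>0 δ>0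
  ... | inj₂ ∣δ∣≈-δ = positive-resp-≈
    (+-cong (∣∣-identity s>0) (pointwise λ 𝔪 →
      R.trans (R.-‿cong (R.trans (R.*-identityˡ _) (at ∣δ∣≈-δ 𝔪))) (R.-‿involutive _)))
    (δ≺s R.1# R.0<1)

  infinite-+-≺ : ∀ {s δ} → Infinite s → δ ≺ s → Infinite (s + δ)
  infinite-+-≺ {s} {δ} inf δ≺s r with positive⊎∣∣-neg δ
  ... | inj₁ δ>0 = positive-resp-≈
    (pointwise λ 𝔪 → R.trans (R.+-assoc _ _ _)
      (R.trans (R.+-congˡ (R.+-comm _ _)) (R.sym (R.+-assoc _ _ _))))
    (positive-+ (inf r) δ>0)
  ... | inj₂ ∣δ∣≈-δ = positive-double⁻ (positive-resp-≈ (pointwise rearrange)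
    (positive-+ (δ≺s (R.1# R.+ R.1#) (R.+-pos R.0<1 R.0<1)) (inf (r R.+ r))))
    where
    open SetoidReasoning R.setoid
    open CommutativeSemigroupProperties R.+-commutativeSemigroup using (interchange)
    neg-double : ∀ x → R.- (x R.+ x) R.≈ R.- x R.+ R.- x
    neg-double x = R.sym (R.-‿+-comm x x)
    rearrange : ∀ 𝔪 →
      coeff ((∣ s ∣ - (R.1# R.+ R.1#) • ∣ δ ∣) + (s - const (r R.+ r))) 𝔪 R.≈
      coeff (((s + δ) - const r) + ((s + δ) - const r)) 𝔪
    rearrange 𝔪 = begin
      ((coeff (∣ s ∣) 𝔪) R.- (R.1# R.+ R.1#) R.* (coeff (∣ δ ∣) 𝔪)) R.+ (a R.- (r R.+ r) R.* i)
        ≈⟨ R.+-cong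
             (R.+-cong (at (∣∣-identity (infinite⇒positive inf)) 𝔪)
               (R.-‿cong (R.trans (R.*-congˡ (at ∣δ∣≈-δ 𝔪))
                 (R.trans (R.distribʳ _ _ _) (R.+-cong (R.*-identityˡ _) (R.*-identityˡ _))))))
             (R.+-congˡ (R.-‿cong (R.distribʳ _ _ _))) ⟩
      (a R.- (R.- d R.+ R.- d)) R.+ (a R.- (r R.* i R.+ r R.* i))
        ≈⟨ R.+-cong
             (R.+-congˡ (R.trans (neg-double (R.- d))
               (R.+-cong (R.-‿involutive d) (R.-‿involutive d))))
             (R.+-congˡ (neg-double (r R.* i))) ⟩
      (a R.+ (d R.+ d)) R.+ (a R.+ (b R.+ b))
        ≈⟨ interchange a (d R.+ d) a (b R.+ b) ⟩
      (a R.+ a) R.+ ((d R.+ d) R.+ (b R.+ b))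
        ≈⟨ R.+-assoc _ _ _ ⟨
      ((a R.+ a) R.+ (d R.+ d)) R.+ (b R.+ b)
        ≈⟨ R.+-congʳ (interchange a a d d) ⟩
      ((a R.+ d) R.+ (a R.+ d)) R.+ (b R.+ b)
        ≈⟨ interchange (a R.+ d) (a R.+ d) b b ⟩
      ((a R.+ d) R.+ b) R.+ ((a R.+ d) R.+ b) ∎
      where
      a = coeff s 𝔪
      d = coeff δ 𝔪
      i = coeff 1ˢ 𝔪
      b = R.- (r R.* i)

  -- Index classes are setoids, so that "finitely many indices" is
  -- counted up to equality of indices.
  module _ {i j} {I : Setoid i j} (F : Func I ≈-setoid) where
    open Setoid I using () renaming (Carrier to Index)
    open FiniteSums I

    record Summable : Set (lsuc κ ⊔ ℓ ⊔ i ⊔ j) where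
      field
        union-wellBased : WellBased (λ 𝔪 → ∃[ a ] supp (Func.to F a) 𝔪)
        point-finite    : ∀ 𝔪 → Finite (λ a → supp (Func.to F a) 𝔪)

    open Summable

    ∑-coeff : Summable → Monomial → R.Carrier
    ∑-coeff σ 𝔪 = sumOver {P = λ a → supp (Func.to F a) 𝔪} (point-finite σ 𝔪) (λ a → coeff (Func.to F a) 𝔪)

    ∑-coeff-cong : ∀ σ {𝔪 𝔫} → 𝔪 N.≈ 𝔫 → ∑-coeff σ 𝔪 R.≈ ∑-coeff σ 𝔫
    ∑-coeff-cong σ {𝔪} {𝔫} 𝔪≈𝔫 =
      sumOver-cong {P = λ a → supp (Func.to F a) 𝔪} {Q = λ a → supp (Func.to F a) 𝔫}
        (point-finite σ 𝔪) (point-finite σ 𝔫)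
        (λ a≈b → at (Func.cong F a≈b) 𝔪) (λ a → coeff-cong (Func.to F a) 𝔪≈𝔫)
        (λ p → p) (λ p → p)

    ∑ : Summable → Series
    ∑ σ .coeff      = ∑-coeff σ
    ∑ σ .coeff-cong = ∑-coeff-cong σ
    ∑ σ .wellBased  = wellBased-⊆
      (λ {𝔪} → total-nonzero (proj₁ (point-finite σ 𝔪))) (union-wellBased σ)

    SumsTo : Series → Set (lsuc κ ⊔ ℓ ⊔ i ⊔ j)
    SumsTo s = Σ[ σ ∈ Summable ] s ≈ ∑ σ

  record IsStronglyLinear (Φ : Series → Series) : Set (lsuc κ ⊔ lsuc ℓ) where
    field
      cong   : ∀ {s t} → s ≈ t → Φ s ≈ Φ t
      +-homo : ∀ s t → Φ (s + t) ≈ Φ s + Φ t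
      •-homo : ∀ r s → Φ (r • s) ≈ r • Φ s

    func : Func ≈-setoid ≈-setoid
    func = record { to = Φ ; cong = cong }

    field
      -- Indices in Set ℓ suffice: the nonzero members of a summable
      -- family can be reindexed by Monomial × ℕ.
      ∑-homo : ∀ {I : Setoid ℓ ℓ} (F : Func I ≈-setoid) (σ : Summable F) →
               SumsTo (Compose.function F func) (Φ (∑ F σ))

  record IsStrongMorphism (Φ : Series → Series) : Set (lsuc κ ⊔ lsuc ℓ) where
    field
      isStronglyLinear : IsStronglyLinear Φ
      *-homo           : ∀ s t → Φ (s * t) ≈ Φ s * Φ t
      1-homo           : Φ 1ˢ ≈ 1ˢ
      <-mono           : ∀ {s t} → s < t → Φ s < Φ t

    open IsStronglyLinear isStronglyLinear public

  module _ {Φ : Series → Series} (Φ-mor : IsStrongMorphism Φ) where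
    open IsStrongMorphism Φ-mor

    preserves-const : ∀ r → Φ (const r) ≈ const r
    preserves-const r = ≈.trans (•-homo r 1ˢ) (•-cong r 1-homo)

    preserves-positive : ∀ {s} → Positive s → Positive (Φ s)
    preserves-positive {s} s>0 = positive-resp-≈
      (≈.trans (+-cong ≈.refl (-‿cong Φ0≈0)) (-0-identity (Φ s)))
      (<-mono {0ˢ} {s} (positive-resp-≈ (≈.sym (-0-identity s)) s>0))
      where
      Φ0≈0 : Φ 0ˢ ≈ 0ˢ
      Φ0≈0 = ≈.trans (cong (≈.sym const-0)) (≈.trans (preserves-const R.0#) const-0)

    preserves-infinite : ∀ {s} → Infinite s → Infinite (Φ s)
    preserves-infinite inf r = positive-resp-≈
      (+-cong ≈.refl (-‿cong (preserves-const r))) (<-mono (inf r))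

  Series⁺ Series× Series∞ : Set (lsuc κ ⊔ ℓ)
  Series⁺ = ∃ Positive
  Series× = ∃ (_≉ 0ˢ)
  Series∞ = ∃ Infinite

  _*⁺_ : Series⁺ → Series⁺ → Series⁺
  (s , s>0) *⁺ (t , t>0) = s * t , positive-* s>0 t>0

  ∣_∣⁺ : Series× → Series⁺
  ∣ s , s≉0 ∣⁺ = ∣ s ∣ , ∣∣-positive s≉0

  mono⁺ : Monomial → Series⁺
  mono⁺ 𝔪 = mono 𝔪 , mono-positive 𝔪

  mono× : Monomial → Series×
  mono× 𝔪 = mono 𝔪 , mono≉0 𝔪

  const⁺ : ∀ {r} → R.0# R.< r → Series⁺
  const⁺ {r} 0<r = const r , const-positive 0<r

  _+⁺_⟨_⟩ : (s : Series⁺) (δ : Series) → δ ≺ proj₁ s → Series⁺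
  (s , s>0) +⁺ δ ⟨ δ≺s ⟩ = s + δ , positive-+-≺ s>0 δ≺s

  _+∞_⟨_⟩ : (s : Series∞) (δ : Series) → δ ≺ proj₁ s → Series∞
  (s , s>𝐑) +∞ δ ⟨ δ≺s ⟩ = s + δ , infinite-+-≺ s>𝐑 δ≺s

  fromℕ : ℕ → R.Carrier
  fromℕ n = n R.· R.1#

  -- The terms (-1)ᵏ εᵏ⁺¹ / (k+1) for k ≥ 0.
  logTerms : Series → Func (≡.setoid ℕ) ≈-setoid
  logTerms ε = record
    { to   = λ k → ((R.- R.1#) R.^ k R.* fromℕ (suc k) R.⁻¹) • ε ^ suc k
    ; cong = λ { ≡.refl → ≈.refl }
    }

  record IsTransserialField (log : Series⁺ → Series) : Set (lsuc κ ⊔ ℓ) where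
    field
      log-cong      : ∀ {s t} → proj₁ s ≈ proj₁ t → log s ≈ log t
      log-injective : ∀ {s t} → log s ≈ log t → proj₁ s ≈ proj₁ t
      log-*         : ∀ s t → log (s *⁺ t) ≈ log s + log t
      log-mono      : ∀ {s t} → proj₁ s < proj₁ t → log s < log t
      log-cancel    : ∀ {s t} → log s < log t → proj₁ s < proj₁ t

      log-monomial  : ∀ 𝔪 → supp (log (mono⁺ 𝔪)) ⊆ (N.ε N.≺_)
      log-≤         : ∀ s → log s ≤ proj₁ s - 1ˢ
      log-1+        : ∀ {ε} (ε≺1 : ε ≺ 1ˢ) →
                      SumsTo (logTerms ε) (log (mono⁺ N.ε +⁺ ε ⟨ ε≺1 ⟩))

      log-const     : ∀ {r} (0<r : R.0# R.< r) → ∃[ q ] log (const⁺ 0<r) ≈ const q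
      log-const-surjective :
        ∀ q → ∃[ r ] Σ[ 0<r ∈ R.0# R.< r ] log (const⁺ 0<r) ≈ const q

  ExponentiallyClosed : (Series⁺ → Series) → Set (lsuc κ ⊔ ℓ)
  ExponentiallyClosed log = ∀ t → ∃[ s ] log s ≈ t

  module Transserial (log : Series⁺ → Series) where

    infix 4 _≺≺_ _≼≼_

    _≺≺_ _≼≼_ : Rel Series× ℓ
    s ≺≺ t = log ∣ s ∣⁺ ≺ log ∣ t ∣⁺
    s ≼≼ t = log ∣ s ∣⁺ ≼ log ∣ t ∣⁺

    record IsTransserialDerivation (∂ : Series → Series) : Set (lsuc κ ⊔ lsuc ℓ) where
      field
        isStronglyLinear : IsStronglyLinear ∂
        leibniz          : ∀ s t → ∂ (s * t) ≈ ∂ s * t + s * ∂ t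
        -- ∂(log|s|) = ∂(s)/s, with the denominator cleared.
        ∂-log            : ∀ (s : Series×) → proj₁ s * ∂ (log ∣ s ∣⁺) ≈ ∂ (proj₁ s)

      open IsStronglyLinear isStronglyLinear public

    IsIdentityOf : (Series → Series) → Pred Series ℓ
    IsIdentityOf ∂ x = Positive x × N.ε ∉ supp x × ∂ x ≈ 1ˢ

    record IsHField (∂ : Series → Series) : Set (lsuc κ ⊔ ℓ) where
      field
        kernel : ∀ {f} → ∂ f ≈ 0ˢ ⇔ (∃[ r ] f ≈ const r)
        ∂-pos  : ∀ {f} → Infinite f → Positive (∂ f)

    IsFlatDerivation : (Series → Series) → Series× → Set ℓ
    IsFlatDerivation ∂ x =
      ∀ {𝔪 𝔫} → 𝔫 ∈ supp (∂ (mono 𝔪)) →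
      ∃[ 𝔣 ] ∃[ 𝔴 ] (mono× 𝔣 ≺≺ mono× 𝔪 × mono× 𝔴 ≼≼ x × 𝔫 N.≈ (𝔪 N.∙ 𝔣) N.∙ 𝔴)

    record IsCompositionLaw (_∘_ : Series → Series∞ → Series) : Set (lsuc κ ⊔ lsuc ℓ) where
      field
        isMorphism : ∀ s → IsStrongMorphism (_∘ s)
        ∘-congʳ    : ∀ f {s t} → proj₁ s ≈ proj₁ t → f ∘ s ≈ f ∘ t
        ∘-log      : ∀ (f : Series⁺) s →
                     log f ∘ s ≈
                     log (proj₁ f ∘ s , preserves-positive (isMorphism s) (proj₂ f))
        ∘-assoc    : ∀ f (s t : Series∞) →
                     f ∘ (proj₁ s ∘ t , preserves-infinite (isMorphism t) (proj₂ s)) ≈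
                     (f ∘ s) ∘ t

      ∘-cong : ∀ {f g} s → f ≈ g → f ∘ s ≈ g ∘ s
      ∘-cong s = IsStrongMorphism.cong (isMorphism s)

    IsCompositionIdentity : (Series → Series∞ → Series) → Pred Series∞ (lsuc κ ⊔ ℓ)
    IsCompositionIdentity _∘_ x = (∀ s → proj₁ x ∘ s ≈ proj₁ s) × (∀ f → f ∘ x ≈ f)

    IsFlatComposition : (Series → Series∞ → Series) → Set (lsuc κ ⊔ ℓ)
    IsFlatComposition _∘_ =
      ∀ (s : Series∞) {𝔪 𝔫} → ¬ (𝔪 N.≈ N.ε) → 𝔫 ∈ supp (mono 𝔪 ∘ s) →
      ∃[ 𝔡 ] ∃[ 𝔣 ] ∃[ 𝔴 ] ∃[ 𝔲 ]
        ( Dominant (mono 𝔪 ∘ s) 𝔡 × 𝔲 ∈ supp (proj₁ s)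
        × mono× 𝔣 ≺≺ mono× 𝔪 × 𝔴 N.≼ N.ε × mono× 𝔴 ≼≼ mono× 𝔲
        × 𝔫 N.≈ (𝔡 N.∙ 𝔣) N.∙ 𝔴)

    ChainRule : (Series → Series) → (Series → Series∞ → Series) → Set (lsuc κ ⊔ ℓ)
    ChainRule ∂ _∘_ = ∀ f s → ∂ (f ∘ s) ≈ ∂ (proj₁ s) * (∂ f ∘ s)

    module Taylor
      {∂ : Series → Series} (∂-der : IsTransserialDerivation ∂)
      {_∘_ : Series → Series∞ → Series} (∘-law : IsCompositionLaw _∘_) where

      open IsTransserialDerivation ∂-der using () renaming (cong to ∂-cong)
      open IsCompositionLaw ∘-law using (∘-cong)

      ∂^ : ℕ → Series → Series
      ∂^ zero    f = f
      ∂^ (suc k) f = ∂ (∂^ k f)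

      ∂^-cong : ∀ k {f g} → f ≈ g → ∂^ k f ≈ ∂^ k g
      ∂^-cong zero    f≈g = f≈g
      ∂^-cong (suc k) f≈g = ∂-cong (∂^-cong k f≈g)

      taylorTerm : Series → Series∞ → Series → ℕ → Series
      taylorTerm f s δ k = (∂^ k f ∘ s) * δ ^ k

      taylorTerm-cong : ∀ {f g} s δ k → f ≈ g → taylorTerm f s δ k ≈ taylorTerm g s δ k
      taylorTerm-cong s δ k f≈g = *-cong (∘-cong s (∂^-cong k f≈g)) ≈.refl

      1/_! : ℕ → R.Carrier
      1/ k ! = fromℕ (k !) R.⁻¹

      supp-setoid : Series → Setoid ℓ ℓ
      supp-setoid f = On.setoid {B = Σ Monomial (supp f)} N.setoid proj₁

      module _ (f : Series) (s : Series∞) (δ : Series) where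

        TaylorConfiguration : Set ℓ
        TaylorConfiguration =
          δ ≺ proj₁ s ×
          (∀ {𝔪} → 𝔪 ∈ supp f → (∂ (mono 𝔪) ∘ s) * δ ≺ mono 𝔪 ∘ s)

        unweightedTerms : Func (×-setoid (supp-setoid f) (≡.setoid ℕ)) ≈-setoid
        unweightedTerms = record
          { to   = λ ((𝔪 , _) , k) → taylorTerm (mono 𝔪) s δ k
          ; cong = λ { {_ , k} (𝔪≈𝔫 , ≡.refl) → taylorTerm-cong s δ k (mono-cong 𝔪≈𝔫) }
          }

        monomialTerms : Func (×-setoid (supp-setoid f) (≡.setoid ℕ)) ≈-setoid
        monomialTerms = record
          { to   = λ ((𝔪 , _) , k) → coeff f 𝔪 • (1/ k ! • taylorTerm (mono 𝔪) s δ k)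
          ; cong = λ { {(𝔪 , _) , k} {(𝔫 , _) , _} (𝔪≈𝔫 , ≡.refl) → ≈.trans
              (•-cong (coeff f 𝔪) (•-cong (1/ k !) (taylorTerm-cong s δ k (mono-cong 𝔪≈𝔫))))
              (pointwise λ _ → R.*-congʳ (coeff-cong f 𝔪≈𝔫)) }
          }

        seriesTerms : Func (≡.setoid ℕ) ≈-setoid
        seriesTerms = record
          { to   = λ k → 1/ k ! • taylorTerm f s δ k
          ; cong = λ { ≡.refl → ≈.refl }
          }

        record TaylorExpansion (δ≺s : δ ≺ proj₁ s) : Set (lsuc κ ⊔ lsuc ℓ) where
          field
            summable       : Summable unweightedTerms
            series-sum     : SumsTo seriesTerms (f ∘ (s +∞ δ ⟨ δ≺s ⟩))
            monomial-sum   : SumsTo monomialTerms (f ∘ (s +∞ δ ⟨ δ≺s ⟩))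
            terms-decrease : ∀ k → taylorTerm f s δ k ≉ 0ˢ →
                             taylorTerm f s δ (suc k) ≺ taylorTerm f s δ k

      HasTaylorExpansions : Set (lsuc κ ⊔ lsuc ℓ)
      HasTaylorExpansions =
        ∀ f s δ (c : TaylorConfiguration f s δ) → TaylorExpansion f s δ (proj₁ c)

  -- 𝐑[[𝔐]], as a class of series over 𝔑.
  SeriesOver : Pred Monomial ℓ → Pred Series ℓ
  SeriesOver 𝔐 s = supp s ⊆ 𝔐

  -- 𝓖 = { x + δ : δ ∈ 𝐑[[𝔐]], δ ≺ x }
  module NearIdentity (𝔐 : Pred Monomial ℓ) (x : Series∞) where

    _∈𝓖 : Pred Series (lsuc κ ⊔ ℓ)
    g ∈𝓖 = ∃[ δ ] (SeriesOver 𝔐 δ × δ ≺ proj₁ x × g ≈ proj₁ x + δ)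

    𝓖 : Set (lsuc κ ⊔ ℓ)
    𝓖 = ∃ _∈𝓖

    _≈ᴳ_ : Rel 𝓖 ℓ
    _≈ᴳ_ = _≈_ on proj₁

    toSeries∞ : 𝓖 → Series∞
    toSeries∞ (g , δ , _ , δ≺x , g≈x+δ) = g , λ r →
      positive-resp-≈ (+-cong (≈.sym g≈x+δ) ≈.refl) (infinite-+-≺ (proj₂ x) δ≺x r)

    -- 𝓖 is closed under ∘, and is a group for the induced operation.
    IsGroupUnder : (Series → Series∞ → Series) → Set (lsuc κ ⊔ ℓ)
    IsGroupUnder _∘_ =
      Σ[ closed ∈ (∀ (g h : 𝓖) → (proj₁ g ∘ toSeries∞ h) ∈𝓖) ]
      Σ[ e ∈ 𝓖 ] Σ[ inv ∈ Op₁ 𝓖 ]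
        IsGroup _≈ᴳ_ (λ g h → (proj₁ g ∘ toSeries∞ h) , closed g h) e inv

{-# OPTIONS --safe #-}
module Submission where

-- The elements x + δ with δ ∈ 𝐑[[𝔐]], δ ≺ x form a monoid under ∘, by strong
-- linearity and the hypothesis on 𝔪 ∘ (x + δ), so it suffices to find right
-- inverses (rightInverses⇒isGroup).  A right inverse x + ε of x + δ is the same
-- thing as a fixed point ε of the map φ(ε) = - δ ∘ (x + ε).
--
-- The map φ is contracting: if ε and η have the same coefficients above a
-- monomial 𝔫, then φ(ε) and φ(η) have the same coefficients at 𝔫 and above
-- (correction-contracting).  By strong linearity this need only be shown for
-- 𝔞 ∘ (x + ε) and 𝔞 ∘ (x + η), where 𝔞 ≺ x is a monomial (mono-contracting).  The
-- H-field axioms give 𝔞′ ≺ 1: every x + r 𝔞 is infinite, so 1 + r 𝔞′ > 0.  If 𝔞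
-- is in Taylor configuration at (x + ε, η - ε), all terms of the Taylor expansion
-- after the first are ≺ 𝔫, because (𝔞′ ∘ (x + ε)) (η - ε) is, and the terms
-- decrease.  The same argument applies with ε and η exchanged.  If neither
-- configuration is available, then 𝔞 ∘ (x + ε) ≼ (𝔞′ ∘ (x + ε)) 𝔫 ≺ 𝔫 and
-- likewise 𝔞 ∘ (x + η) ≺ 𝔫, so neither has a coefficient at 𝔫 or above.
--
-- A contracting map determines its fixed point from the top monomial downwards.
-- Its approximants, the series that agree with their image down to each monomial
-- of their support, cohere, and their union is a fixed point provided that it is
-- a series (limit-fixed).  Well-orderedness is automatic, but as 𝔑 may be a
-- proper class it has to be shown that the union of the supports is a set
-- (reached-small).  For each of the set-many 𝔞 ∈ supp δ choose, if possible, one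
-- approximant ε and one cut 𝔟 in its support such that 𝔞 is in Taylor
-- configuration at the part of x + ε above 𝔟.  Each monomial reached by an
-- approximant lies in supp (𝔞 ∘ (x + ε′)) for some 𝔞 ∈ supp δ and some truncated
-- approximant ε′, and expanding 𝔞 at the chosen point shows by induction that it
-- is a product of monomials from the supports of the chosen approximants and of
-- the Taylor coefficients at the chosen points, which form a set.

open import Defs
open import Axiom.ExcludedMiddle using (ExcludedMiddle)
open import Algebra.Core using (Op₁; Op₂)
open import Algebra.Structures using (IsGroup; IsMonoid)
open import Data.List.Base using (List; []; _∷_; _++_)
open import Data.List.Relation.Unary.All using ([])
open import Data.List.Relation.Unary.AllPairs using ([]; _∷_)
open import Data.List.Relation.Unary.Any using (here)
open import Data.Empty.Polymorphic using (⊥)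
open import Data.Nat.Base using (ℕ; zero; suc)
open import Data.Product.Base using (Σ; Σ-syntax; ∃; ∃-syntax; _×_; _,_; proj₁; proj₂)
open import Data.Sum.Base using (_⊎_; inj₁; inj₂; [_,_]′)
open import Function.Bundles using (Func)
import Function.Construct.Composition as Compose
open import Induction.WellFounded using (Acc; acc)
open import Level using (Level; Lift; lift; _⊔_) renaming (suc to lsuc)
open import Relation.Binary.Bundles using (Setoid)
open import Relation.Binary.Core using (Rel)
open import Relation.Binary.Definitions using (tri<; tri≈; tri>)
open import Relation.Binary.PropositionalEquality as ≡ using (_≡_)
import Relation.Binary.Reasoning.Setoid as SetoidReasoning
open import Relation.Nullary using (¬_; Dec; yes; no; contradiction)
open import Relation.Nullary.Decidable using (decidable-stable)
open import Relation.Unary using (Pred; _∈_; _⊆_; _∪_)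

-- Groups from right inverses

-- A monoid in which every element has a right inverse is a group.
rightInverses⇒isGroup : ∀ {a ℓ} {A : Set a} {_≈_ : Rel A ℓ} {_∙_ : Op₂ A} {ε : A} {_⁻¹ : Op₁ A} →
                        IsMonoid _≈_ _∙_ ε → (∀ x → (x ∙ (x ⁻¹)) ≈ ε) → IsGroup _≈_ _∙_ ε _⁻¹
rightInverses⇒isGroup {_≈_ = _≈_} {_∙_} {ε} {_⁻¹} isMonoid inverseʳ = record
  { isMonoid = isMonoid
  ; inverse  = inverseˡ , inverseʳ
  ; ⁻¹-cong  = λ {x} {y} x≈y → begin
      x ⁻¹               ≈⟨ identityʳ _ ⟨
      (x ⁻¹) ∙ ε           ≈⟨ ∙-congˡ (inverseʳ y) ⟨
      (x ⁻¹) ∙ (y ∙ (y ⁻¹))  ≈⟨ assoc _ _ _ ⟨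
      ((x ⁻¹) ∙ y) ∙ (y ⁻¹)  ≈⟨ ∙-congʳ (∙-congˡ x≈y) ⟨
      ((x ⁻¹) ∙ x) ∙ (y ⁻¹)  ≈⟨ ∙-congʳ (inverseˡ x) ⟩
      ε ∙ (y ⁻¹)           ≈⟨ identityˡ _ ⟩
      y ⁻¹               ∎
  }
  where
  open IsMonoid isMonoid
  open SetoidReasoning setoid
  inverseˡ : ∀ x → ((x ⁻¹) ∙ x) ≈ ε
  inverseˡ x = begin
    (x ⁻¹) ∙ x                        ≈⟨ ∙-congˡ (identityʳ x) ⟨
    (x ⁻¹) ∙ (x ∙ ε)                  ≈⟨ ∙-congˡ (∙-congˡ (inverseʳ (x ⁻¹))) ⟨
    (x ⁻¹) ∙ (x ∙ ((x ⁻¹) ∙ ((x ⁻¹) ⁻¹)))   ≈⟨ ∙-congˡ (assoc _ _ _) ⟨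
    (x ⁻¹) ∙ ((x ∙ (x ⁻¹)) ∙ ((x ⁻¹) ⁻¹))   ≈⟨ ∙-congˡ (∙-congʳ (inverseʳ x)) ⟩
    (x ⁻¹) ∙ (ε ∙ ((x ⁻¹) ⁻¹))            ≈⟨ ∙-congˡ (identityˡ _) ⟩
    (x ⁻¹) ∙ ((x ⁻¹) ⁻¹)                ≈⟨ inverseʳ (x ⁻¹) ⟩
    ε                                 ∎

-- Ordered fields

module OrderedFieldProperties {c ℓ₁ ℓ₂} (𝐑 : OrderedField c ℓ₁ ℓ₂) where
  open OrderedField 𝐑
  open OrderedFieldLemmas 𝐑
  open import Algebra.Properties.Ring ring

  ⁻¹-inverseˡ : ∀ x → ¬ (x ≈ 0#) → x ⁻¹ * x ≈ 1#
  ⁻¹-inverseˡ x x≉0 = trans (*-comm _ _) (⁻¹-inverseʳ x x≉0)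

  ⁻¹-pos : ∀ {x} → 0# < x → 0# < x ⁻¹
  ⁻¹-pos {x} 0<x with compare 0# (x ⁻¹)
  ... | tri< p _ _ = p
  ... | tri≈ _ p _ = contradiction
    (trans (trans (sym (zeroʳ x)) (*-congˡ p)) (⁻¹-inverseʳ x (pos⇒≉0 0<x))) 0≉1
  ... | tri> _ _ p = contradiction 0<1 (<-asym
    (<-respˡ-≈ (+-identityʳ 1#) (<-respʳ-≈ (-‿inverseʳ 1#) (+-monoʳ-< 1# 0<-1))))
    where
    0<-1 : 0# < - 1#
    0<-1 = <-respʳ-≈ (trans (sym (-‿distribʳ-* x (x ⁻¹))) (-‿cong (⁻¹-inverseʳ x (pos⇒≉0 0<x))))
             (*-pos 0<x (neg⇒-pos p))

  1⁻¹≈1 : ∀ {x} → x ≈ 1# → x ⁻¹ ≈ 1#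
  1⁻¹≈1 {x} x≈1 = trans (sym (*-identityˡ _)) (trans (*-congʳ (sym x≈1))
    (⁻¹-inverseʳ x λ x≈0 → 0≉1 (trans (sym x≈0) x≈1)))

  <⇒-neg : ∀ {x y} → x < y → x - y < 0#
  <⇒-neg {x} {y} x<y =
    <-respˡ-≈ (+-comm (- y) x) (<-respʳ-≈ (-‿inverseˡ y) (+-monoʳ-< (- y) x<y))

  -- Some positive multiple of c exceeds b: the multiplier ranges over the whole
  -- field, so this is not the Archimedean property.
  exceeds : ∀ b {c} → 0# < c → ∃[ r ] (0# < r × b < r * c)
  exceeds b {c} 0<c with compare 0# b
  ... | tri< 0<b _ _ = (b + 1#) * c ⁻¹ , *-pos (+-pos 0<b 0<1) (⁻¹-pos 0<c) ,
    <-respʳ-≈ (sym (trans (*-assoc _ _ _) (trans (*-congˡ (⁻¹-inverseˡ c (pos⇒≉0 0<c)))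
      (*-identityʳ _)))) (<-respˡ-≈ (+-identityʳ b) (+-monoʳ-< b 0<1))
  ... | tri≈ _ 0≈b _ = 1# , 0<1 , <-respʳ-≈ (sym (*-identityˡ c)) (<-respˡ-≈ 0≈b 0<c)
  ... | tri> _ _ b<0 = 1# , 0<1 , <-respʳ-≈ (sym (*-identityˡ c)) (<-trans b<0 0<c)

-- Well-based series

module SeriesProperties
  (em : ∀ {a} → ExcludedMiddle a) (κ : Level) {ℓ : Level}
  (𝐑 : OrderedField ℓ ℓ ℓ) (𝔑 : OrderedAbelianGroup ℓ ℓ ℓ) where

  open WellBasedSeries em κ 𝐑 𝔑
  open OrderedFieldProperties 𝐑

  ≼-refl : ∀ {𝔞} → 𝔞 N.≼ 𝔞
  ≼-refl = N.≺-irrefl N.refl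

  ≼-trans : ∀ {𝔞 𝔟 𝔠} → 𝔞 N.≼ 𝔟 → 𝔟 N.≼ 𝔠 → 𝔞 N.≼ 𝔠
  ≼-trans 𝔞≼𝔟 𝔟≼𝔠 𝔠≺𝔞 = 𝔞≼𝔟 (≼≺-trans 𝔟≼𝔠 𝔠≺𝔞)

  ≺⇒≼ : ∀ {𝔞 𝔟} → 𝔞 N.≺ 𝔟 → 𝔞 N.≼ 𝔟
  ≺⇒≼ = N.≺-asym

  ≈⇒≼ : ∀ {𝔞 𝔟} → 𝔞 N.≈ 𝔟 → 𝔞 N.≼ 𝔟
  ≈⇒≼ 𝔞≈𝔟 = N.≺-irrefl (N.sym 𝔞≈𝔟)

  ≺≼-trans : ∀ {𝔞 𝔟 𝔠} → 𝔞 N.≺ 𝔟 → 𝔟 N.≼ 𝔠 → 𝔞 N.≺ 𝔠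
  ≺≼-trans 𝔞≺𝔟 𝔟≼𝔠 with ≼-cases 𝔟≼𝔠
  ... | inj₁ 𝔟≺𝔠 = N.≺-trans 𝔞≺𝔟 𝔟≺𝔠
  ... | inj₂ 𝔟≈𝔠 = N.≺-respʳ-≈ 𝔟≈𝔠 𝔞≺𝔟

  ≺ε-∙ : ∀ {𝔟 𝔠 𝔫} → 𝔟 N.≺ N.ε → 𝔠 N.≼ 𝔫 → 𝔟 N.∙ 𝔠 N.≺ 𝔫
  ≺ε-∙ {𝔠 = 𝔠} 𝔟≺ε 𝔠≼𝔫 = ≺≼-trans (N.≺-respʳ-≈ (N.identityˡ 𝔠) (∙-monoˡ-≺ 𝔠 𝔟≺ε)) 𝔠≼𝔫

  -- Supports and asymptotic comparison

  vanishes : ∀ s {𝔪} → ¬ supp s 𝔪 → coeff s 𝔪 R.≈ R.0#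
  vanishes s {𝔪} = decidable-stable (coeff s 𝔪 R.≈? R.0#)

  ∄supp⇒≈0 : ∀ {s} → (∀ {𝔪} → ¬ supp s 𝔪) → s ≈ 0ˢ
  ∄supp⇒≈0 {s} none = pointwise λ _ → vanishes s none

  supp-•⁻ : ∀ r s → supp (r • s) ⊆ supp s
  supp-•⁻ r s ≉0 ≈0 = ≉0 (R.trans (R.*-congˡ ≈0) (R.zeroʳ r))

  supp-neg⁻ : ∀ s → supp (- s) ⊆ supp s
  supp-neg⁻ s ≉0 ≈0 = ≉0 (R.trans (R.-‿cong ≈0) R.-0#≈0#)

  supp-neg⁺ : ∀ s → supp s ⊆ supp (- s)
  supp-neg⁺ s ≉0 -≈0 = ≉0 (R.trans (R.sym (R.-‿involutive _)) (R.trans (R.-‿cong -≈0) R.-0#≈0#))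

  supp-mono⁺ : ∀ 𝔪 → supp (mono 𝔪) 𝔪
  supp-mono⁺ 𝔪 = proj₁ (Positive.isDominant (mono-positive 𝔪))

  supp-mono⁻ : ∀ {𝔪 𝔫} → supp (mono 𝔪) 𝔫 → 𝔫 N.≈ 𝔪
  supp-mono⁻ {𝔪} {𝔫} = indicator-supp (𝔫 N.≈? 𝔪)

  ∣∣-cases : ∀ s → ∣ s ∣ ≈ s ⊎ ∣ s ∣ ≈ - s
  ∣∣-cases s with em {P = Positive s}
  ... | yes _ = inj₁ ≈.refl
  ... | no _  = inj₂ ≈.refl

  supp-∣∣⁻ : ∀ s → supp ∣ s ∣ ⊆ supp s
  supp-∣∣⁻ s 𝔪∈ with ∣∣-cases s
  ... | inj₁ eq = supp-resp-≈ eq 𝔪∈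
  ... | inj₂ eq = supp-neg⁻ s (supp-resp-≈ eq 𝔪∈)

  supp-∣∣⁺ : ∀ s → supp s ⊆ supp ∣ s ∣
  supp-∣∣⁺ s 𝔪∈ with ∣∣-cases s
  ... | inj₁ eq = supp-resp-≈ (≈.sym eq) 𝔪∈
  ... | inj₂ eq = supp-resp-≈ (≈.sym eq) (supp-neg⁺ s 𝔪∈)

  -- s ⊰ 𝔫 says that supp s ≺ 𝔫.  Unlike s ≺ mono 𝔫 it does not involve absolute
  -- values; ⊰⇒≺ and ≺⇒⊰ translate between the two.
  infix 4 _⊰_
  _⊰_ : Series → Monomial → Set ℓ
  s ⊰ 𝔫 = ∀ {𝔪} → supp s 𝔪 → 𝔪 N.≺ 𝔫

  ⊰-vanishes : ∀ {s 𝔫 𝔪} → s ⊰ 𝔫 → 𝔫 N.≼ 𝔪 → coeff s 𝔪 R.≈ R.0#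
  ⊰-vanishes {s} s⊰𝔫 𝔫≼𝔪 = vanishes s λ 𝔪∈s → 𝔫≼𝔪 (s⊰𝔫 𝔪∈s)

  dominant-+-⊰ : ∀ {s t 𝔡} → Dominant s 𝔡 → t ⊰ 𝔡 → Dominant (s + t) 𝔡
  dominant-+-⊰ {s} {t} (𝔡∈s , max) t⊰𝔡 =
    (λ ≈0 → 𝔡∈s (R.trans (R.sym (R.trans (R.+-congˡ (⊰-vanishes {t} t⊰𝔡 ≼-refl)) (R.+-identityʳ _))) ≈0)) ,
    λ 𝔪∈ → [ max , (λ 𝔪∈t → ≺⇒≼ (t⊰𝔡 𝔪∈t)) ]′ (+-supp s t 𝔪∈)

  positive-+-⊰ : ∀ {s t} (s>0 : Positive s) → t ⊰ Positive.monomial s>0 → Positive (s + t)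
  positive-+-⊰ {s} {t} (positive d 0<) t⊰𝔡 = positive (dominant-+-⊰ {s} {t} d t⊰𝔡)
    (R.<-respʳ-≈ (R.sym (R.trans (R.+-congˡ (⊰-vanishes {t} t⊰𝔡 ≼-refl)) (R.+-identityʳ _))) 0<)

  abstract
    ⊰⇒≺ : ∀ {s t 𝔡} → supp t 𝔡 → s ⊰ 𝔡 → s ≺ t
    ⊰⇒≺ {s} {t} {𝔡} 𝔡∈t s⊰𝔡 r 0<r =
      positive-+-⊰ ∣t∣>0 λ 𝔪∈ → ≺≼-trans
        (s⊰𝔡 (supp-∣∣⁻ s (supp-•⁻ r ∣ s ∣ (supp-neg⁻ (r • ∣ s ∣) 𝔪∈))))
        (proj₂ (Positive.isDominant ∣t∣>0) (supp-∣∣⁺ t 𝔡∈t))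
      where
      ∣t∣>0 : Positive ∣ t ∣
      ∣t∣>0 = ∣∣-positive λ t≈0 → 𝔡∈t (at t≈0 𝔡)

  -- A bound of the support of a positive series carries a nonnegative coefficient.
  positive-coeff : ∀ {s 𝔞} → Positive s → (∀ {𝔪} → supp s 𝔪 → 𝔪 N.≼ 𝔞) → ¬ (coeff s 𝔞 R.< R.0#)
  positive-coeff {s} {𝔞} (positive {𝔢} (𝔢∈s , max) 0<) bound <0 with ≼-cases (bound 𝔢∈s)
  ... | inj₁ 𝔢≺𝔞 = max (λ ≈0 → R.<-irrefl ≈0 <0) 𝔢≺𝔞
  ... | inj₂ 𝔢≈𝔞 = R.<-asym 0< (R.<-respˡ-≈ (coeff-cong s (N.sym 𝔢≈𝔞)) <0)

  -- If supp s is not below 𝔡, then the leading monomial 𝔞 of s bounds supp t, and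
  -- ∣ t ∣ - r ∣ s ∣ has a negative coefficient at 𝔞 for large r.
  ≺⇒⊰ : ∀ {s t 𝔡} → s ≺ t → Dominant t 𝔡 → s ⊰ 𝔡
  ≺⇒⊰ {s} {t} {𝔡} s≺t (_ , maxᵗ) {𝔪} 𝔪∈s with em {P = 𝔪 N.≺ 𝔡}
  ... | yes 𝔪≺𝔡 = 𝔪≺𝔡
  ... | no 𝔡≼𝔪 with ∣∣-positive {s} (λ s≈0 → 𝔪∈s (at s≈0 𝔪))
  ...   | positive {𝔞} (_ , maxˢ) 0<c with exceeds (coeff ∣ t ∣ 𝔞) 0<c
  ...     | r , 0<r , b<rc = contradiction (<⇒-neg b<rc) (positive-coeff (s≺t r 0<r) bound)
    where
    bound : ∀ {𝔫} → supp (∣ t ∣ - r • ∣ s ∣) 𝔫 → 𝔫 N.≼ 𝔞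
    bound 𝔫∈ with +-supp ∣ t ∣ (- (r • ∣ s ∣)) 𝔫∈
    ... | inj₁ 𝔫∈t = ≼-trans (maxᵗ (supp-∣∣⁻ t 𝔫∈t)) (≼-trans 𝔡≼𝔪 (maxˢ (supp-∣∣⁺ s 𝔪∈s)))
    ... | inj₂ 𝔫∈s = maxˢ (supp-•⁻ r ∣ s ∣ (supp-neg⁻ (r • ∣ s ∣) 𝔫∈s))

  •-≺ : ∀ r {s t} → Positive t → s ≺ t → r • s ≺ t
  •-≺ r {s} {t} (positive d _) s≺t =
    ⊰⇒≺ {r • s} {t} (proj₁ d) λ 𝔪∈ → ≺⇒⊰ {s} {t} s≺t d (supp-•⁻ r s 𝔪∈)

  ≺⇒positive : ∀ {s t} → Positive t → s ≺ t → ∀ r → Positive (t + r • s)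
  ≺⇒positive t>0 s≺t r = positive-+-≺ t>0 (•-≺ r t>0 s≺t)

  -- With ≺⇒positive, this describes s ≺ t for positive t by the positivity of all
  -- t + r s, a condition free of absolute values and transported by linear maps.
  positive⇒≺ : ∀ {s t} → (∀ r → Positive (t + r • s)) → s ≺ t
  positive⇒≺ {s} {t} pos r _ with ∣∣-cases s
  ... | inj₁ eq = positive-resp-≈
    (+-cong (≈.sym (∣∣-identity t>0)) (pointwise λ 𝔪 → R.trans (R.sym (R.-‿distribˡ-* r _))
      (R.-‿cong (R.*-congˡ (R.sym (at eq 𝔪)))))) (pos (R.- r))
    where t>0 = positive-resp-≈ (pointwise λ _ → R.trans (R.+-congˡ (R.zeroˡ _)) (R.+-identityʳ _)) (pos R.0#)
  ... | inj₂ eq = positive-resp-≈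
    (+-cong (≈.sym (∣∣-identity t>0)) (pointwise λ 𝔪 →
      R.trans (R.sym (R.-‿involutive _)) (R.-‿cong (R.trans (R.-‿distribʳ-* r _)
        (R.*-congˡ (R.sym (at eq 𝔪))))))) (pos r)
    where t>0 = positive-resp-≈ (pointwise λ _ → R.trans (R.+-congˡ (R.zeroˡ _)) (R.+-identityʳ _)) (pos R.0#)

  -- Cauchy products

  module _ (s t : Series) where

    -- A Cauchy product coefficient to which only one pair of monomials contributes.
    *-coeff-single : ∀ {𝔪 𝔞} → Sums.Support (cauchyTerm s t 𝔪) ⊆ (N._≈ 𝔞) →
                     coeff (s * t) 𝔪 R.≈ coeff s 𝔞 R.* coeff t (𝔞 N.⁻¹ N.∙ 𝔪)
    *-coeff-single {𝔪} {𝔞} only = R.trans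
      (Sums.sumOver-cong {P = Sums.Support (cauchyTerm s t 𝔪)} {Q = N._≈ 𝔞}
        (cauchyFinite s t 𝔪) (𝔞 ∷ [] , [] ∷ [] , here)
        (cauchyTerm-cong s t N.refl) (λ _ → R.refl) (λ p → p) only)
      (R.+-identityʳ _)

    *-≉0 : s ≉ 0ˢ → t ≉ 0ˢ → s * t ≉ 0ˢ
    *-≉0 s≉0 t≉0 st≈0 with dominant s≉0 | dominant t≉0
    ... | 𝔞 , 𝔞∈s , maxˢ | 𝔟 , 𝔟∈t , maxᵗ = R.*-nonzero 𝔞∈s 𝔟∈t
      (R.trans (R.*-congˡ (coeff-cong t (N.sym (cancelˡ′ 𝔞 𝔟))))
        (R.trans (R.sym (*-coeff-single only)) (at st≈0 (𝔞 N.∙ 𝔟))))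
      where
      only : Sums.Support (cauchyTerm s t (𝔞 N.∙ 𝔟)) ⊆ (N._≈ 𝔞)
      only {𝔠} ≉0 with cauchyTerm-supp s t ≉0
      ... | 𝔠∈s , 𝔡∈t with ≼-cases (maxˢ 𝔠∈s)
      ...   | inj₂ 𝔠≈𝔞 = 𝔠≈𝔞
      ...   | inj₁ 𝔠≺𝔞 = contradiction
        (N.≺-respʳ-≈ (N.sym (cancelˡ 𝔠 (𝔞 N.∙ 𝔟))) (∙-monoˡ-≺ 𝔟 𝔠≺𝔞))
        (∙-mono-≼ ≼-refl (maxᵗ 𝔡∈t))

    *-zeroˡ : s ≈ 0ˢ → s * t ≈ 0ˢ
    *-zeroˡ s≈0 = ∄supp⇒≈0 λ 𝔪∈ → let (𝔞 , _ , 𝔞∈s , _) = cauchySum-supp s t 𝔪∈ in 𝔞∈s (at s≈0 𝔞)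

    *-zeroʳ : t ≈ 0ˢ → s * t ≈ 0ˢ
    *-zeroʳ t≈0 = ∄supp⇒≈0 λ 𝔪∈ → let (_ , 𝔟 , _ , 𝔟∈t , _) = cauchySum-supp s t 𝔪∈ in 𝔟∈t (at t≈0 𝔟)

  *-identityʳ : ∀ s → s * 1ˢ ≈ s
  *-identityʳ s = pointwise λ 𝔪 → R.trans
    (*-coeff-single s 1ˢ λ {𝔞} ≉0 → N.sym (N.trans (N.sym (cancelˡ 𝔞 𝔪))
      (N.trans (N.∙-congˡ (supp-mono⁻ (proj₂ (cauchyTerm-supp s 1ˢ ≉0)))) (N.identityʳ 𝔞))))
    (R.trans (R.*-congˡ (indicator-yes (N.inverseˡ 𝔪) ((𝔪 N.⁻¹ N.∙ 𝔪) N.≈? N.ε))) (R.*-identityʳ _))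

  -- Sums of families and strongly linear maps

  sum-supp : ∀ {i j} {I : Setoid i j} (F : Func I ≈-setoid) {s 𝔫} → SumsTo F s → supp s 𝔫 →
             ∃[ a ] supp (Func.to F a) 𝔫
  sum-supp {I = I} F {𝔫 = 𝔫} (σ , s≈∑) 𝔫∈s =
    FiniteSums.total-nonzero I (proj₁ (Summable.point-finite σ 𝔫)) (supp-resp-≈ s≈∑ 𝔫∈s)

  -- The family of terms f(𝔪) 𝔪 of f, indexed by all monomials; those outside the
  -- support contribute zero.
  monomialTerms : Series → Func N.setoid ≈-setoid
  monomialTerms f = record
    { to   = λ 𝔪 → coeff f 𝔪 • mono 𝔪
    ; cong = λ {𝔪} {𝔫} 𝔪≈𝔫 → ≈.trans (•-cong (coeff f 𝔪) (mono-cong 𝔪≈𝔫))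
        (pointwise λ _ → R.*-congʳ (coeff-cong f 𝔪≈𝔫))
    }

  monomialTerms-sum : ∀ f → SumsTo (monomialTerms f) f
  monomialTerms-sum f = σ , pointwise λ 𝔪 → R.sym (R.trans (R.+-identityʳ _)
      (R.trans (R.*-congˡ (indicator-yes N.refl (𝔪 N.≈? 𝔪))) (R.*-identityʳ _)))
    where
    index : ∀ {𝔞 𝔪} → supp (coeff f 𝔞 • mono 𝔞) 𝔪 → 𝔪 N.≈ 𝔞
    index {𝔞} 𝔪∈ = supp-mono⁻ (supp-•⁻ (coeff f 𝔞) (mono 𝔞) 𝔪∈)
    σ : Summable (monomialTerms f)
    σ = record
      { union-wellBased = wellBased-⊆
          (λ (𝔞 , 𝔪∈) 𝔪∉f → 𝔪∈ (R.trans
            (R.*-congʳ (R.trans (coeff-cong f (N.sym (index 𝔪∈))) 𝔪∉f)) (R.zeroˡ _)))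
          (wellBased f)
      ; point-finite = λ 𝔪 → 𝔪 ∷ [] , [] ∷ [] , λ 𝔪∈ → here (N.sym (index 𝔪∈))
      }

  module _ {Φ : Series → Series} (Φ-lin : IsStronglyLinear Φ) where
    open IsStronglyLinear Φ-lin

    0-homo : ∀ {s} → s ≈ 0ˢ → Φ s ≈ 0ˢ
    0-homo {s} s≈0 = ≈.trans (cong (≈.trans s≈0 (pointwise λ _ → R.sym (R.zeroˡ _))))
      (≈.trans (•-homo R.0# s) (pointwise λ _ → R.zeroˡ _))

    monomialImages : Series → Func N.setoid ≈-setoid
    monomialImages f = Compose.function (monomialTerms f) func

    monomialImages-sum : ∀ f → SumsTo (monomialImages f) (Φ f)
    monomialImages-sum f with monomialTerms-sum f
    ... | σ , f≈∑ with ∑-homo (monomialTerms f) σ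
    ...   | τ , eq = τ , ≈.trans (cong f≈∑) eq

    image-supp : ∀ f {𝔫} → supp (Φ f) 𝔫 → ∃[ 𝔪 ] (supp f 𝔪 × supp (Φ (mono 𝔪)) 𝔫)
    image-supp f {𝔫} 𝔫∈ with sum-supp (monomialImages f) (monomialImages-sum f) 𝔫∈
    ... | 𝔪 , 𝔫∈′ with supp-resp-≈ (•-homo (coeff f 𝔪) (mono 𝔪)) 𝔫∈′
    ...   | ≉0 = 𝔪 , (λ ≈0 → ≉0 (R.trans (R.*-congʳ ≈0) (R.zeroˡ _))) ,
                 supp-•⁻ (coeff f 𝔪) (Φ (mono 𝔪)) ≉0

  image-agree : ∀ {Φ Ψ} (Φ-lin : IsStronglyLinear Φ) (Ψ-lin : IsStronglyLinear Ψ) f {𝔫} →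
                (∀ {𝔪} → supp f 𝔪 → coeff (Φ (mono 𝔪)) 𝔫 R.≈ coeff (Ψ (mono 𝔪)) 𝔫) →
                coeff (Φ f) 𝔫 R.≈ coeff (Ψ f) 𝔫
  image-agree {Φ} {Ψ} Φ-lin Ψ-lin f {𝔫} agree
    with monomialImages-sum Φ-lin f | monomialImages-sum Ψ-lin f
  ... | σ , eqΦ | τ , eqΨ = R.trans (at eqΦ 𝔫) (R.trans
      (Sums.sumOver-cong
        {P = λ 𝔪 → supp (Func.to (monomialImages Φ-lin f) 𝔪) 𝔫}
        {Q = λ 𝔪 → supp (Func.to (monomialImages Ψ-lin f) 𝔪) 𝔫}
        (Summable.point-finite σ 𝔫) (Summable.point-finite τ 𝔫)
        (λ 𝔞≈𝔟 → at (Func.cong (monomialImages Φ-lin f) 𝔞≈𝔟) 𝔫) same (λ p → p) (λ p → p))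
      (R.sym (at eqΨ 𝔫)))
    where
    same : ∀ 𝔪 → coeff (Φ (coeff f 𝔪 • mono 𝔪)) 𝔫 R.≈ coeff (Ψ (coeff f 𝔪 • mono 𝔪)) 𝔫
    same 𝔪 = R.trans (at (IsStronglyLinear.•-homo Φ-lin _ _) 𝔫)
      (R.trans scaled (R.sym (at (IsStronglyLinear.•-homo Ψ-lin _ _) 𝔫)))
      where
      scaled : coeff f 𝔪 R.* coeff (Φ (mono 𝔪)) 𝔫 R.≈ coeff f 𝔪 R.* coeff (Ψ (mono 𝔪)) 𝔫
      scaled with coeff f 𝔪 R.≈? R.0#
      ... | no 𝔪∈f = R.*-congˡ (agree 𝔪∈f)
      ... | yes ≈0 = R.trans (R.trans (R.*-congʳ ≈0) (R.zeroˡ _))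
                       (R.sym (R.trans (R.*-congʳ ≈0) (R.zeroˡ _)))

  module _ {Φ : Series → Series} (Φ-mor : IsStrongMorphism Φ) where
    open IsStrongMorphism Φ-mor

    preserves-≺ : ∀ {s t} → Positive t → s ≺ t → Φ s ≺ Φ t
    preserves-≺ {s} {t} t>0 s≺t = positive⇒≺ λ r → positive-resp-≈
      (≈.trans (+-homo t (r • s)) (+-cong ≈.refl (•-homo r s)))
      (preserves-positive Φ-mor (≺⇒positive t>0 s≺t r))

    preserves-≉0 : ∀ {s} → s ≉ 0ˢ → Φ s ≉ 0ˢ
    preserves-≉0 {s} s≉0 Φs≈0 with ≉0⇒positive⊎negative s≉0
    ... | inj₁ s>0  = positive⇒≉0 (preserves-positive Φ-mor s>0) Φs≈0
    ... | inj₂ -s>0 = positive⇒≉0 (preserves-positive Φ-mor -s>0)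
      (≈.trans (cong (pointwise λ 𝔪 → R.sym (R.-1*x≈-x (coeff s 𝔪)))) (≈.trans (•-homo (R.- R.1#) s)
        (pointwise λ 𝔪 → R.trans (R.*-congˡ (at Φs≈0 𝔪)) (R.zeroʳ _))))

  -- Agreement of series and truncation

  -- Equality of coefficients above 𝔫, respectively at 𝔫 and above.
  Agree≻ Agree≽ : Monomial → Series → Series → Set ℓ
  Agree≻ 𝔫 s t = ∀ {𝔪} → 𝔫 N.≺ 𝔪 → coeff s 𝔪 R.≈ coeff t 𝔪
  Agree≽ 𝔫 s t = ∀ {𝔪} → 𝔫 N.≼ 𝔪 → coeff s 𝔪 R.≈ coeff t 𝔪

  greatestDifference : ∀ s t {𝔪} → ¬ (coeff s 𝔪 R.≈ coeff t 𝔪) →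
    ∃[ 𝔡 ] (𝔪 N.≼ 𝔡 × ¬ (coeff s 𝔡 R.≈ coeff t 𝔡) × Agree≻ 𝔡 s t)
  greatestDifference s t {𝔪} ≉ with
    greatest {Q = λ 𝔡 → ¬ (coeff s 𝔡 R.≈ coeff t 𝔡)}
      (proj₂ (wellBased-∪ (wellBased s) (wellBased t))) inUnion (𝔪 , ≉)
    where
    inUnion : ∀ {𝔡} → ¬ (coeff s 𝔡 R.≈ coeff t 𝔡) → (supp s ∪ supp t) 𝔡
    inUnion {𝔡} ≉ with coeff s 𝔡 R.≈? R.0#
    ... | no s≉0  = inj₁ s≉0
    ... | yes s≈0 = inj₂ λ t≈0 → ≉ (R.trans s≈0 (R.sym t≈0))
  ... | 𝔡 , 𝔡≉ , max = 𝔡 , max ≉ , 𝔡≉ , λ {𝔫} 𝔡≺𝔫 →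
    decidable-stable (coeff s 𝔫 R.≈? coeff t 𝔫) λ 𝔫≉ → max 𝔫≉ 𝔡≺𝔫

  -- A sum of terms that are all below 𝔫, except the first, equals its first term
  -- at 𝔫 and above.
  sum-leading : (F : Func (≡.setoid ℕ) ≈-setoid) → ∀ {s 𝔫} → SumsTo F s →
                (∀ k → Func.to F (suc k) ⊰ 𝔫) → Agree≽ 𝔫 s (Func.to F 0)
  sum-leading F (σ , s≈∑) lower {𝔪} 𝔫≼𝔪 = R.trans (at s≈∑ 𝔪) (R.trans
      (FiniteSums.sumOver-cong (≡.setoid ℕ)
        {P = λ k → supp (Func.to F k) 𝔪} {Q = _≡ 0}
        (Summable.point-finite σ 𝔪) (0 ∷ [] , [] ∷ [] , here)
        (λ { ≡.refl → R.refl }) (λ _ → R.refl) (λ p → p) leading)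
      (R.+-identityʳ _))
    where
    leading : ∀ {k} → supp (Func.to F k) 𝔪 → k ≡ 0
    leading {zero}  _  = ≡.refl
    leading {suc k} 𝔪∈ = contradiction (lower k 𝔪∈) 𝔫≼𝔪

  -- The coefficient c if P holds, and 0 otherwise.
  when : ∀ {p} {P : Set p} → Dec P → R.Carrier → R.Carrier
  when (yes _) c = c
  when (no _)  _ = R.0#

  when-cong : ∀ {p q} {P : Set p} {Q : Set q} (d : Dec P) (e : Dec Q) → (P → Q) → (Q → P) →
              ∀ {b c} → b R.≈ c → when d b R.≈ when e c
  when-cong (yes _) (yes _) _ _ b≈c = b≈c
  when-cong (no _)  (no _)  _ _ _   = R.refl
  when-cong (yes p) (no ¬q) f _ _   = contradiction (f p) ¬q
  when-cong (no ¬p) (yes q) _ g _   = contradiction (g q) ¬p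

  when-yes : ∀ {p} {P : Set p} (d : Dec P) → P → ∀ {c} → when d c R.≈ c
  when-yes (yes _) _ = R.refl
  when-yes (no ¬p) p = contradiction p ¬p

  when-supp : ∀ {p} {P : Set p} (d : Dec P) {c} → ¬ (when d c R.≈ R.0#) → P × ¬ (c R.≈ R.0#)
  when-supp (yes p) ≉0 = p , ≉0
  when-supp (no _)  ≉0 = contradiction R.refl ≉0

  -- The part of s above 𝔫, excluding 𝔫 itself.
  truncate : Monomial → Series → Series
  truncate 𝔫 s .coeff 𝔪 = when (em {P = 𝔫 N.≺ 𝔪}) (coeff s 𝔪)
  truncate 𝔫 s .coeff-cong 𝔪≈𝔪′ =
    when-cong em em (N.≺-respʳ-≈ 𝔪≈𝔪′) (N.≺-respʳ-≈ (N.sym 𝔪≈𝔪′)) (coeff-cong s 𝔪≈𝔪′)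
  truncate 𝔫 s .wellBased = wellBased-⊆ (λ ≉0 → proj₂ (when-supp em ≉0)) (wellBased s)

  truncate-supp : ∀ 𝔫 s {𝔪} → supp (truncate 𝔫 s) 𝔪 → 𝔫 N.≺ 𝔪 × supp s 𝔪
  truncate-supp 𝔫 s = when-supp em

  truncate-agree : ∀ 𝔫 s → Agree≻ 𝔫 (truncate 𝔫 s) s
  truncate-agree 𝔫 s 𝔫≺𝔪 = when-yes em 𝔫≺𝔪

  -- Classes of monomials that are sets

  small-⋃ : ∀ {p} {A : Set κ} {P : A → Pred Monomial p} → (∀ a → Small (P a)) →
            Small (λ 𝔪 → ∃[ a ] P a 𝔪)
  small-⋃ {A = A} small =
    (Σ A λ a → proj₁ (small a)) , (λ (a , i) → proj₁ (proj₂ (small a)) i) ,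
    λ (a , p) → let (i , eq) = proj₂ (proj₂ (small a)) p in (a , i) , eq

  small-⋃ℕ : ∀ {p} {P : ℕ → Pred Monomial p} → (∀ k → Small (P k)) → Small (λ 𝔪 → ∃[ k ] P k 𝔪)
  small-⋃ℕ small with small-⋃ {A = Lift κ ℕ} (λ (lift k) → small k)
  ... | A , f , covers = A , f , λ (k , p) → covers (lift k , p)

  small-∪ : ∀ {p q} {P : Pred Monomial p} {Q : Pred Monomial q} → Small P → Small Q → Small (P ∪ Q)
  small-∪ (A , f , coversP) (B , g , coversQ) = (A ⊎ B) , [ f , g ]′ ,
    λ { (inj₁ p) → let (a , eq) = coversP p in inj₁ a , eq
      ; (inj₂ q) → let (b , eq) = coversQ q in inj₂ b , eq }

  -- The submonoid of monomials generated by P.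
  data Generated {p} (P : Pred Monomial p) : Pred Monomial (ℓ ⊔ p) where
    generator : ∀ {𝔪} → P 𝔪 → Generated P 𝔪
    unit      : Generated P N.ε
    product   : ∀ {𝔪 𝔫} → Generated P 𝔪 → Generated P 𝔫 → Generated P (𝔪 N.∙ 𝔫)
    resp      : ∀ {𝔪 𝔫} → 𝔪 N.≈ 𝔫 → Generated P 𝔪 → Generated P 𝔫

  -- A monoid generated by a set is covered by the words over that set.
  small-generated : ∀ {p} {P : Pred Monomial p} → Small P → Small (Generated P)
  small-generated {P = P} (A , f , covers) = List A , eval , words
    where
    eval : List A → Monomial
    eval []       = N.ε
    eval (a ∷ as) = f a N.∙ eval as
    eval-++ : ∀ as bs → eval (as ++ bs) N.≈ eval as N.∙ eval bs
    eval-++ []       bs = N.sym (N.identityˡ _)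
    eval-++ (a ∷ as) bs = N.trans (N.∙-congˡ (eval-++ as bs)) (N.sym (N.assoc _ _ _))
    words : ∀ {𝔪} → Generated P 𝔪 → ∃[ as ] eval as N.≈ 𝔪
    words (generator p) = let (a , eq) = covers p in a ∷ [] , N.trans (N.identityʳ _) eq
    words unit          = [] , N.refl
    words (product g h) with words g | words h
    ... | as , eq | bs , eq′ = as ++ bs , N.trans (eval-++ as bs) (N.∙-cong eq eq′)
    words (resp 𝔪≈𝔫 g)  = let (as , eq) = words g in as , N.trans eq 𝔪≈𝔫

  supp-^ : ∀ {p} {P : Pred Monomial p} {s} → supp s ⊆ Generated P → ∀ k → supp (s ^ k) ⊆ Generated P
  supp-^ s⊆ zero 𝔪∈ = resp (N.sym (supp-mono⁻ 𝔪∈)) unit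
  supp-^ {s = s} s⊆ (suc k) 𝔪∈ =
    let (_ , _ , 𝔞∈ , 𝔟∈ , eq) = cauchySum-supp s (s ^ k) 𝔪∈
    in resp eq (product (s⊆ 𝔞∈) (supp-^ s⊆ k 𝔟∈))

  -- Fixed points of contracting maps

  -- A map φ on 𝐑[[P]] such that the coefficients of φ(ε) at 𝔫 and above depend only
  -- on those of ε above 𝔫.  Its values are series over P.
  module FixedPoint (P : Pred Monomial ℓ) (φ : ∃ (SeriesOver P) → Series)
    (φ-over : ∀ ε → φ ε ∈ SeriesOver P)
    (contracting : ∀ ε η 𝔫 → Agree≻ 𝔫 (proj₁ ε) (proj₁ η) → Agree≽ 𝔫 (φ ε) (φ η)) where

    -- Series that agree with their image down to each monomial of their support:
    -- initial parts of the fixed point.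
    Approximant : Pred (∃ (SeriesOver P)) ℓ
    Approximant ε = ∀ 𝔫 → supp (proj₁ ε) 𝔫 → Agree≽ 𝔫 (proj₁ ε) (φ ε)

    -- Monomials in the support of some approximant.
    Reached : Pred Monomial (lsuc κ ⊔ ℓ)
    Reached 𝔫 = ∃[ ε ] (Approximant ε × supp (proj₁ ε) 𝔫)

    -- Two approximants agree wherever both of them are already determined: at their
    -- greatest difference at or above 𝔪 each equals its image, and the images agree.
    coherent : ∀ {ε η 𝔭 𝔮 𝔪} → Approximant ε → Approximant η →
               supp (proj₁ ε) 𝔭 → supp (proj₁ η) 𝔮 → 𝔭 N.≼ 𝔪 → 𝔮 N.≼ 𝔪 →
               coeff (proj₁ ε) 𝔪 R.≈ coeff (proj₁ η) 𝔪
    coherent {ε} {η} {𝔪 = 𝔪} ap aq 𝔭∈ 𝔮∈ 𝔭≼𝔪 𝔮≼𝔪 =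
      decidable-stable (coeff (proj₁ ε) 𝔪 R.≈? coeff (proj₁ η) 𝔪) λ ≉ →
        let (𝔡 , 𝔪≼𝔡 , 𝔡≉ , above) = greatestDifference (proj₁ ε) (proj₁ η) ≉
        in 𝔡≉ (R.trans (ap _ 𝔭∈ (≼-trans 𝔭≼𝔪 𝔪≼𝔡))
             (R.trans (contracting ε η 𝔡 above ≼-refl) (R.sym (aq _ 𝔮∈ (≼-trans 𝔮≼𝔪 𝔪≼𝔡)))))

    -- The union of all approximants, and the proof that it is fixed.
    module _ (small : Small Reached) where

      limitAt : ∀ {𝔫} → Dec (Reached 𝔫) → R.Carrier
      limitAt {𝔫} (yes (ε , _)) = coeff (proj₁ ε) 𝔫
      limitAt     (no _)        = R.0#

      limitAt-supp : ∀ {𝔫} (d : Dec (Reached 𝔫)) → ¬ (limitAt d R.≈ R.0#) → Reached 𝔫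
      limitAt-supp (yes p) _  = p
      limitAt-supp (no _)  ≉0 = contradiction R.refl ≉0

      -- The limit extends each approximant, independently of the chosen one.
      limitAt-approx : ∀ {ε 𝔫 𝔪} → Approximant ε → supp (proj₁ ε) 𝔫 → 𝔫 N.≼ 𝔪 →
                       (d : Dec (Reached 𝔪)) → limitAt d R.≈ coeff (proj₁ ε) 𝔪
      limitAt-approx {ε} {𝔪 = 𝔪} ap 𝔫∈ε 𝔫≼𝔪 (yes (η , aq , 𝔪∈η)) =
        coherent {η} {ε} aq ap 𝔪∈η 𝔫∈ε ≼-refl 𝔫≼𝔪
      limitAt-approx {ε} ap 𝔫∈ε 𝔫≼𝔪 (no none) = R.sym (vanishes (proj₁ ε) λ 𝔪∈ε → none (ε , ap , 𝔪∈ε))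

      limitAt-cong : ∀ {𝔪 𝔫} → 𝔪 N.≈ 𝔫 → (d : Dec (Reached 𝔪)) (e : Dec (Reached 𝔫)) →
                     limitAt d R.≈ limitAt e
      limitAt-cong 𝔪≈𝔫 (yes (ε , ap , 𝔪∈ε)) e = R.trans (coeff-cong (proj₁ ε) 𝔪≈𝔫)
        (R.sym (limitAt-approx {ε} ap 𝔪∈ε (≈⇒≼ 𝔪≈𝔫) e))
      limitAt-cong 𝔪≈𝔫 (no _) (no _) = R.refl
      limitAt-cong 𝔪≈𝔫 (no none) (yes (ε , ap , 𝔫∈ε)) =
        contradiction (ε , ap , supp-resp (proj₁ ε) (N.sym 𝔪≈𝔫) 𝔫∈ε) none

      limitSupport : Pred Monomial ℓ
      limitSupport 𝔫 = ¬ (limitAt (em {P = Reached 𝔫}) R.≈ R.0#)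

      -- An approximant ε whose support contains 𝔮 already contains every monomial of
      -- the limit that is at least 𝔮, so maxima can be taken in supp ε.
      limitSupport-maxima : ∀ {Q : Pred Monomial ℓ} → Q ⊆ limitSupport → ∃ Q → ∃ (Greatest Q)
      limitSupport-maxima {Q} Q⊆ (𝔮 , 𝔮∈Q) with limitAt-supp em (Q⊆ 𝔮∈Q)
      ... | ε , ap , 𝔮∈ε with greatest {Q = λ 𝔪 → Q 𝔪 × 𝔮 N.≼ 𝔪} (proj₂ (wellBased (proj₁ ε)))
              (λ (𝔪∈Q , 𝔮≼𝔪) ≈0 → Q⊆ 𝔪∈Q (R.trans (limitAt-approx {ε} ap 𝔮∈ε 𝔮≼𝔪 em) ≈0))
              (𝔮 , 𝔮∈Q , ≼-refl)
      ...   | 𝔪 , (𝔪∈Q , 𝔮≼𝔪) , max = 𝔪 , 𝔪∈Q , λ 𝔫∈Q 𝔪≺𝔫 →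
        max (𝔫∈Q , ≺⇒≼ (≼≺-trans 𝔮≼𝔪 𝔪≺𝔫)) 𝔪≺𝔫

      limit : Series
      limit .coeff 𝔫        = limitAt (em {P = Reached 𝔫})
      limit .coeff-cong 𝔪≈𝔫 = limitAt-cong 𝔪≈𝔫 em em
      limit .wellBased      =
        (proj₁ small , proj₁ (proj₂ small) , λ ≉0 → proj₂ (proj₂ small) (limitAt-supp em ≉0)) ,
        fromGreatest limitSupport-maxima

      limit-over : limit ∈ SeriesOver P
      limit-over 𝔫∈ = let (ε , _ , 𝔫∈ε) = limitAt-supp em 𝔫∈ in proj₂ ε 𝔫∈ε

      limit-approximant : Approximant (limit , limit-over)
      limit-approximant 𝔫 𝔫∈ 𝔫≼𝔪 with limitAt-supp em 𝔫∈
      ... | ε , ap , 𝔫∈ε = R.trans (agree 𝔫≼𝔪) (R.trans (ap 𝔫 𝔫∈ε 𝔫≼𝔪)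
          (contracting ε (limit , limit-over) 𝔫 (λ 𝔫≺𝔪 → R.sym (agree (≺⇒≼ 𝔫≺𝔪))) 𝔫≼𝔪))
        where
        agree : Agree≽ 𝔫 limit (proj₁ ε)
        agree 𝔫≼𝔪 = limitAt-approx {ε} ap 𝔫∈ε 𝔫≼𝔪 em

      -- At the greatest monomial 𝔡 where the limit E differs from φ(E), adding the term
      -- of φ(E) at 𝔡 to E gives a further approximant.  So 𝔡 was already reached, although
      -- it lies below supp E.
      limit-fixed : limit ≈ φ (limit , limit-over)
      limit-fixed = pointwise λ 𝔪 → decidable-stable (_ R.≈? _) λ ≉ →
          let (𝔡 , _ , 𝔡≉ , above) = greatestDifference limit (φ E) ≉ in extend 𝔡≉ above
        where
        E : ∃ (SeriesOver P)
        E = limit , limit-over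
        extend : ∀ {𝔡} → ¬ (coeff limit 𝔡 R.≈ coeff (φ E) 𝔡) → ¬ Agree≻ 𝔡 limit (φ E)
        extend {𝔡} 𝔡≉ above = limitAt-supp⁺ (E⁺ , E⁺-approximant , 𝔡∈E⁺)
          where
          above𝔡 : ∀ {𝔫} → supp limit 𝔫 → 𝔡 N.≺ 𝔫
          above𝔡 {𝔫} 𝔫∈ with em {P = 𝔡 N.≺ 𝔫}
          ... | yes 𝔡≺𝔫 = 𝔡≺𝔫
          ... | no 𝔫≼𝔡  = contradiction (limit-approximant 𝔫 𝔫∈ 𝔫≼𝔡) 𝔡≉
          𝔡∉E : coeff limit 𝔡 R.≈ R.0#
          𝔡∉E = vanishes limit λ 𝔡∈ → N.≺-irrefl N.refl (above𝔡 𝔡∈)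
          𝔡∈φE : supp (φ E) 𝔡
          𝔡∈φE ≈0 = 𝔡≉ (R.trans 𝔡∉E (R.sym ≈0))
          term : Series
          term = coeff (φ E) 𝔡 • mono 𝔡
          term-supp : ∀ {𝔪} → supp term 𝔪 → 𝔪 N.≈ 𝔡
          term-supp 𝔪∈ = supp-mono⁻ (supp-•⁻ (coeff (φ E) 𝔡) (mono 𝔡) 𝔪∈)
          E⁺-supp : ∀ {𝔪} → supp (limit + term) 𝔪 → supp limit 𝔪 ⊎ 𝔪 N.≈ 𝔡
          E⁺-supp 𝔪∈ with +-supp limit term 𝔪∈
          ... | inj₁ p = inj₁ p
          ... | inj₂ q = inj₂ (term-supp q)
          E⁺ : ∃ (SeriesOver P)
          E⁺ = limit + term , λ 𝔪∈ → [ limit-over , (λ 𝔪≈𝔡 →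
            φ-over E (supp-resp (φ E) (N.sym 𝔪≈𝔡) 𝔡∈φE)) ]′ (E⁺-supp 𝔪∈)
          E⁺≈E : Agree≻ 𝔡 (limit + term) limit
          E⁺≈E 𝔡≺𝔪 = R.trans (R.+-congˡ (vanishes term λ 𝔪∈ → N.≺-irrefl (N.sym (term-supp 𝔪∈)) 𝔡≺𝔪))
                       (R.+-identityʳ _)
          E⁺𝔡 : coeff (limit + term) 𝔡 R.≈ coeff (φ E) 𝔡
          E⁺𝔡 = R.trans (R.+-cong 𝔡∉E (R.trans (R.*-congˡ (indicator-yes N.refl (𝔡 N.≈? 𝔡)))
                  (R.*-identityʳ _))) (R.+-identityˡ _)
          𝔡∈E⁺ : supp (limit + term) 𝔡
          𝔡∈E⁺ ≈0 = 𝔡∈φE (R.trans (R.sym E⁺𝔡) ≈0)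
          E⁺-agree : Agree≽ 𝔡 (limit + term) (φ E)
          E⁺-agree 𝔡≼𝔪 with ≼-cases 𝔡≼𝔪
          ... | inj₁ 𝔡≺𝔪 = R.trans (E⁺≈E 𝔡≺𝔪) (above 𝔡≺𝔪)
          ... | inj₂ 𝔡≈𝔪 = R.trans (coeff-cong (limit + term) (N.sym 𝔡≈𝔪))
                             (R.trans E⁺𝔡 (coeff-cong (φ E) 𝔡≈𝔪))
          E⁺-approximant : Approximant E⁺
          E⁺-approximant 𝔫 𝔫∈ 𝔫≼𝔪 = R.trans (E⁺-agree 𝔡≼𝔪)
              (contracting E E⁺ 𝔡 (λ 𝔡≺𝔪 → R.sym (E⁺≈E 𝔡≺𝔪)) 𝔡≼𝔪)
            where
            𝔡≼𝔪 = ≼-trans ([ (λ 𝔫∈E → ≺⇒≼ (above𝔡 𝔫∈E)) , (λ 𝔫≈𝔡 → ≈⇒≼ (N.sym 𝔫≈𝔡)) ]′ (E⁺-supp 𝔫∈)) 𝔫≼𝔪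
          limitAt-supp⁺ : ¬ Reached 𝔡
          limitAt-supp⁺ (ε , ap , 𝔡∈ε) = 𝔡∈ε (R.trans (R.sym (limitAt-approx {ε} ap 𝔡∈ε ≼-refl em)) 𝔡∉E)

-- Composition with series x + ε, ε ≺ x

module CompositionNearIdentity
  (em : ∀ {a} → ExcludedMiddle a) (κ : Level) {ℓ : Level}
  (𝐑 : OrderedField ℓ ℓ ℓ) (𝔑 : OrderedAbelianGroup ℓ ℓ ℓ)
  (log : WellBasedSeries.Series⁺ em κ 𝐑 𝔑 → WellBasedSeries.Series em κ 𝐑 𝔑) where

  open WellBasedSeries em κ 𝐑 𝔑
  open Transserial log
  open OrderedFieldProperties 𝐑
  open SeriesProperties em κ 𝐑 𝔑

  module _
    (x : Series∞) (𝔵 : Monomial) (x≈𝔵 : proj₁ x ≈ mono 𝔵)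
    (∂ : Series → Series) (∂-derivation : IsTransserialDerivation ∂)
    (∂x≈1 : ∂ (proj₁ x) ≈ 1ˢ) (hField : IsHField ∂)
    (_∘_ : Series → Series∞ → Series) (∘-law : IsCompositionLaw _∘_)
    (∘-identity : IsCompositionIdentity _∘_ x)
    (taylor : Taylor.HasTaylorExpansions ∂-derivation ∘-law) where

    open Taylor ∂-derivation ∘-law hiding (monomialTerms)
    open IsCompositionLaw ∘-law
    module ∂ = IsTransserialDerivation ∂-derivation
    module Comp (s : Series∞) = IsStrongMorphism (isMorphism s)

    -- Estimates at leading order

    dominant-x : Dominant (proj₁ x) 𝔵
    dominant-x = supp-resp-≈ (≈.sym x≈𝔵) (supp-mono⁺ 𝔵) ,
                 λ 𝔪∈ → ≈⇒≼ (supp-mono⁻ (supp-resp-≈ x≈𝔵 𝔪∈))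

    ≺x : ∀ {ε} → ε ⊰ 𝔵 → ε ≺ proj₁ x
    ≺x {ε} = ⊰⇒≺ {ε} {proj₁ x} (proj₁ dominant-x)

    ≺x⁻ : ∀ {ε} → ε ≺ proj₁ x → ε ⊰ 𝔵
    ≺x⁻ {ε} ε≺x = ≺⇒⊰ {ε} {proj₁ x} ε≺x dominant-x

    -- The ball of all ε ≺ x, with the condition stated on supports.
    Ball : Set (lsuc κ ⊔ ℓ)
    Ball = ∃ (_⊰ 𝔵)

    abstract
      -- Composition does not depend on this proof, by ∘-congʳ, so it stays abstract.
      x⊕-infinite : (ε : Ball) → Infinite (proj₁ x + proj₁ ε)
      x⊕-infinite (ε , ε⊰𝔵) = infinite-+-≺ (proj₂ x) (≺x ε⊰𝔵)

    -- The series x + ε.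
    x⊕_ : Ball → Series∞
    x⊕ ε = proj₁ x + proj₁ ε , x⊕-infinite ε

    dominant-x⊕ : ∀ ε → Dominant (proj₁ (x⊕ ε)) 𝔵
    dominant-x⊕ (ε , ε⊰𝔵) = dominant-+-⊰ {proj₁ x} {ε} dominant-x ε⊰𝔵

    -- For f ≺ x the series x + r f is infinite, so that its derivative 1 + r f′ is
    -- positive, for every r.
    ∂-infinitesimal : ∀ {f} → f ⊰ 𝔵 → ∂ f ≺ 1ˢ
    ∂-infinitesimal {f} f⊰𝔵 = positive⇒≺ λ r → positive-resp-≈
      (≈.trans (∂.+-homo (proj₁ x) (r • f)) (+-cong ∂x≈1 (∂.•-homo r f)))
      (IsHField.∂-pos hField (infinite-+-≺ (proj₂ x)
        (•-≺ r {f} (infinite⇒positive (proj₂ x)) (≺x f⊰𝔵))))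

    ∂-∘-infinitesimal : ∀ {f} s → f ⊰ 𝔵 → ∂ f ∘ s ⊰ N.ε
    ∂-∘-infinitesimal {f} s f⊰𝔵 = ≺⇒⊰ {∂ f ∘ s} {1ˢ ∘ s}
      (preserves-≺ (isMorphism s) (mono-positive N.ε) (∂-infinitesimal f⊰𝔵))
      (supp-resp-≈ (≈.sym (Comp.1-homo s)) (supp-mono⁺ N.ε) ,
       λ 𝔪∈ → ≈⇒≼ (supp-mono⁻ (supp-resp-≈ (Comp.1-homo s) 𝔪∈)))

    -- Since ∘ preserves ≺, f ∘ (x + ε) ≺ x ∘ (x + ε) = x + ε, whose leading monomial is 𝔵.
    ∘-⊰𝔵 : ∀ {f} ε → f ⊰ 𝔵 → f ∘ (x⊕ ε) ⊰ 𝔵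
    ∘-⊰𝔵 {f} ε f⊰𝔵 = ≺⇒⊰ {f ∘ (x⊕ ε)} {proj₁ x ∘ (x⊕ ε)}
      (preserves-≺ (isMorphism (x⊕ ε)) (infinite⇒positive (proj₂ x)) (≺x f⊰𝔵))
      (supp-resp-≈ (≈.sym x∘s≈s) (proj₁ dom) , λ 𝔪∈ → proj₂ dom (supp-resp-≈ x∘s≈s 𝔪∈))
      where
      x∘s≈s = proj₁ ∘-identity (x⊕ ε)
      dom = dominant-x⊕ ε

    -- Taylor expansions and contraction

    -- (𝔞′ ∘ (x + ε)) 𝔫 ≺ 𝔞 ∘ (x + ε), in terms of supports.  This puts 𝔞 in Taylor
    -- configuration at (x + ε, ζ) for all ζ ≺ x with no monomial above 𝔫.
    Controlled : Monomial → Ball → Monomial → Set ℓ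
    Controlled 𝔞 ε 𝔫 = ∃[ 𝔡 ] (supp (mono 𝔞 ∘ (x⊕ ε)) 𝔡 ×
      (∀ {𝔟} → supp (∂ (mono 𝔞) ∘ (x⊕ ε)) 𝔟 → 𝔟 N.∙ 𝔫 N.≺ 𝔡))

    mono⊰ : ∀ {𝔞} → 𝔞 N.≺ 𝔵 → mono 𝔞 ⊰ 𝔵
    mono⊰ 𝔞≺𝔵 𝔪∈ = N.≺-respˡ-≈ (N.sym (supp-mono⁻ 𝔪∈)) 𝔞≺𝔵

    -- Failure of the configuration gives 𝔞 ∘ (x + ε) ≼ (𝔞′ ∘ (x + ε)) 𝔫, which is ≺ 𝔫
    -- because 𝔞′ ∘ (x + ε) ≺ 1.
    ¬controlled⇒⊰ : ∀ {𝔞 𝔫} ε → 𝔞 N.≺ 𝔵 → ¬ Controlled 𝔞 ε 𝔫 → mono 𝔞 ∘ (x⊕ ε) ⊰ 𝔫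
    ¬controlled⇒⊰ {𝔞} {𝔫} ε 𝔞≺𝔵 ¬c {𝔡} 𝔡∈
      with em {P = ∃[ 𝔟 ] (supp (∂ (mono 𝔞) ∘ (x⊕ ε)) 𝔟 × 𝔡 N.≼ 𝔟 N.∙ 𝔫)}
    ... | yes (𝔟 , 𝔟∈ , 𝔡≼𝔟𝔫) =
      ≼≺-trans 𝔡≼𝔟𝔫 (≺ε-∙ (∂-∘-infinitesimal (x⊕ ε) (mono⊰ 𝔞≺𝔵) 𝔟∈) ≼-refl)
    ... | no none = contradiction
      (𝔡 , 𝔡∈ , λ {𝔟} 𝔟∈ → decidable-stable em λ ¬≺ → none (𝔟 , 𝔟∈ , ¬≺)) ¬c

    -- Taylor expansion of 𝔞 at x + ε with increment ζ = η - ε.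
    module _ {𝔞 𝔫 : Monomial} (ε η : Ball) (𝔞≺𝔵 : 𝔞 N.≺ 𝔵) (controlled : Controlled 𝔞 ε 𝔫)
             (agree : Agree≻ 𝔫 (proj₁ ε) (proj₁ η)) where

      private
        s = x⊕ ε
        ζ = proj₁ η - proj₁ ε

      difference-≼ : ∀ {𝔪} → supp ζ 𝔪 → 𝔪 N.≼ 𝔫
      difference-≼ 𝔪∈ζ 𝔫≺𝔪 = 𝔪∈ζ (R.trans (R.+-congʳ (R.sym (agree 𝔫≺𝔪))) (R.-‿inverseʳ _))

      difference-⊰ : ζ ⊰ 𝔵
      difference-⊰ 𝔪∈ = [ proj₂ η , (λ 𝔪∈ → proj₂ ε (supp-neg⁻ (proj₁ ε) 𝔪∈)) ]′
        (+-supp (proj₁ η) (- proj₁ ε) 𝔪∈)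

      abstract
        configuration : TaylorConfiguration (mono 𝔞) s ζ
        configuration = ⊰⇒≺ {ζ} {proj₁ s} (proj₁ (dominant-x⊕ ε)) difference-⊰ , λ {𝔪} 𝔪∈ →
          let (𝔡 , 𝔡∈ , ≺𝔡) = controlled
              𝔪≈𝔞 = mono-cong (supp-mono⁻ 𝔪∈)
          in ⊰⇒≺ {(∂ (mono 𝔪) ∘ s) * ζ} {mono 𝔪 ∘ s}
               (supp-resp-≈ (∘-cong s (≈.sym 𝔪≈𝔞)) 𝔡∈)
               λ 𝔫∈ → let (𝔟 , 𝔠 , 𝔟∈ , 𝔠∈ , eq) = cauchySum-supp (∂ (mono 𝔪) ∘ s) ζ 𝔫∈
                 in N.≺-respˡ-≈ eq (≼≺-trans (∙-mono-≼ ≼-refl (difference-≼ 𝔠∈))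
                      (≺𝔡 (supp-resp-≈ (∘-cong s (∂.cong 𝔪≈𝔞)) 𝔟∈)))

      expansion : TaylorExpansion (mono 𝔞) s ζ (proj₁ configuration)
      expansion = taylor (mono 𝔞) s ζ configuration

      -- The endpoint (x + ε) + ζ of the expansion is x + η.
      expansion-sum : SumsTo (seriesTerms (mono 𝔞) s ζ) (mono 𝔞 ∘ (x⊕ η))
      expansion-sum with TaylorExpansion.series-sum expansion
      ... | σ , eq = σ , ≈.trans (∘-congʳ (mono 𝔞) (pointwise λ 𝔪 → shift _ _ _)) eq
        where
        shift : ∀ a b c → a R.+ c R.≈ (a R.+ b) R.+ (c R.- b)
        shift a b c = R.sym (R.trans (R.+-assoc a b _) (R.+-congˡ (R.trans (R.+-comm b _)
          (R.trans (R.+-assoc c _ b) (R.trans (R.+-congˡ (R.-‿inverseˡ b)) (R.+-identityʳ c))))))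

      term : ℕ → Series
      term = taylorTerm (mono 𝔞) s ζ

      -- The hypothesis that terms decrease is silent after a zero term; all terms that
      -- follow one are zero as well.
      term-zero : ∀ k → term k ≈ 0ˢ → term (suc k) ≈ 0ˢ
      term-zero k ≈0 = zero-factor em em
        where
        zero-factor : Dec (∂^ k (mono 𝔞) ≈ 0ˢ) → Dec (ζ ^ k ≈ 0ˢ) → term (suc k) ≈ 0ˢ
        zero-factor (yes f≈0) _ = *-zeroˡ (∂^ (suc k) (mono 𝔞) ∘ s) (ζ ^ suc k)
          (0-homo (Comp.isStronglyLinear s) (0-homo ∂.isStronglyLinear f≈0))
        zero-factor (no _) (yes ζ≈0) = *-zeroʳ (∂^ (suc k) (mono 𝔞) ∘ s) (ζ ^ suc k)
          (*-zeroʳ ζ (ζ ^ k) ζ≈0)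
        zero-factor (no f≉0) (no ζ≉0) = contradiction ≈0
          (*-≉0 (∂^ k (mono 𝔞) ∘ s) (ζ ^ k) (preserves-≉0 (isMorphism s) f≉0) ζ≉0)

      -- The first-order term is ≺ 𝔫 because 𝔞′ ∘ (x + ε) ≺ 1 and ζ has no monomial above
      -- 𝔫; the later terms are smaller still.
      term-⊰ : ∀ k → term (suc k) ⊰ 𝔫
      term-⊰ zero 𝔪∈ =
        let (𝔟 , 𝔠 , 𝔟∈ , 𝔠∈ , eq) = cauchySum-supp (∂ (mono 𝔞) ∘ s) (ζ * 1ˢ) 𝔪∈
        in N.≺-respˡ-≈ eq (≺ε-∙ (∂-∘-infinitesimal s (mono⊰ 𝔞≺𝔵) 𝔟∈)
             (difference-≼ (supp-resp-≈ {ζ * 1ˢ} {ζ} (*-identityʳ ζ) 𝔠∈)))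
      term-⊰ (suc k) = next em
        where
        next : Dec (term (suc k) ≈ 0ˢ) → term (suc (suc k)) ⊰ 𝔫
        next (yes ≈0) {𝔪} 𝔪∈ = contradiction (at (term-zero (suc k) ≈0) 𝔪) 𝔪∈
        next (no ≉0) 𝔪∈ =
          let (𝔡 , dom) = dominant {term (suc k)} ≉0
          in N.≺-trans
               (≺⇒⊰ {term (suc (suc k))} {term (suc k)}
                 (TaylorExpansion.terms-decrease expansion (suc k) ≉0) dom 𝔪∈)
               (term-⊰ k (proj₁ dom))

      controlled-agree : Agree≽ 𝔫 (mono 𝔞 ∘ (x⊕ η)) (mono 𝔞 ∘ s)
      controlled-agree {𝔪} 𝔫≼𝔪 = R.trans
        (sum-leading (seriesTerms (mono 𝔞) s ζ) expansion-sum
          (λ k 𝔪∈ → term-⊰ k (supp-•⁻ (1/ suc k !) (term (suc k)) 𝔪∈)) 𝔫≼𝔪)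
        (R.trans (R.*-congʳ (1⁻¹≈1 (R.+-identityʳ R.1#)))
          (R.trans (R.*-identityˡ _) (at (*-identityʳ (mono 𝔞 ∘ s)) 𝔪)))

      -- The support of 𝔞 ∘ (x + η) lies in the monoid generated by the supports of the
      -- Taylor coefficients and of the increment.
      controlled-supp : ∀ {p} {P : Pred Monomial p} →
        (∀ k → supp (∂^ k (mono 𝔞) ∘ s) ⊆ P) → supp ζ ⊆ Generated P →
        supp (mono 𝔞 ∘ (x⊕ η)) ⊆ Generated P
      controlled-supp coeffs⊆ ζ⊆ 𝔪∈ =
        let (k , 𝔪∈k) = sum-supp (seriesTerms (mono 𝔞) s ζ) expansion-sum 𝔪∈
            (_ , _ , 𝔟∈ , 𝔠∈ , eq) = cauchySum-supp (∂^ k (mono 𝔞) ∘ s) (ζ ^ k)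
              (supp-•⁻ (1/ k !) (term k) 𝔪∈k)
        in resp eq (product (generator (coeffs⊆ k 𝔟∈)) (supp-^ ζ⊆ k 𝔠∈))

    mono-contracting : ∀ {𝔞} (ε η : Ball) 𝔫 → 𝔞 N.≺ 𝔵 → Agree≻ 𝔫 (proj₁ ε) (proj₁ η) →
                       Agree≽ 𝔫 (mono 𝔞 ∘ (x⊕ ε)) (mono 𝔞 ∘ (x⊕ η))
    mono-contracting {𝔞} ε η 𝔫 𝔞≺𝔵 agree 𝔫≼𝔪
      with em {P = Controlled 𝔞 ε 𝔫} | em {P = Controlled 𝔞 η 𝔫}
    ... | yes c | _     = R.sym (controlled-agree ε η 𝔞≺𝔵 c agree 𝔫≼𝔪)
    ... | no _  | yes c = controlled-agree η ε 𝔞≺𝔵 c (λ 𝔫≺𝔪 → R.sym (agree 𝔫≺𝔪)) 𝔫≼𝔪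
    ... | no ¬c | no ¬d = R.trans (⊰-vanishes {mono 𝔞 ∘ (x⊕ ε)} (¬controlled⇒⊰ ε 𝔞≺𝔵 ¬c) 𝔫≼𝔪)
      (R.sym (⊰-vanishes {mono 𝔞 ∘ (x⊕ η)} (¬controlled⇒⊰ η 𝔞≺𝔵 ¬d) 𝔫≼𝔪))

    -- The fixed-point equation for right inverses

    module _ (𝔐 : Pred Monomial ℓ)
      (∘-over : ∀ {𝔪 δ} → 𝔪 ∈ 𝔐 → δ ∈ SeriesOver 𝔐 → (δ≺x : δ ≺ proj₁ x) →
                (mono 𝔪 ∘ (x +∞ δ ⟨ δ≺x ⟩)) ∈ SeriesOver 𝔐) where

      open NearIdentity 𝔐 x

      -- The elements of 𝐑[[𝔐]] that are ≺ x are the series over 𝔐≺𝔵.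
      𝔐≺𝔵 : Pred Monomial ℓ
      𝔐≺𝔵 𝔫 = 𝔐 𝔫 × 𝔫 N.≺ 𝔵

      ball : ∃ (SeriesOver 𝔐≺𝔵) → Ball
      ball (ε , over) = ε , λ 𝔪∈ → proj₂ (over 𝔪∈)

      ∘-over-ball : ∀ {δ} → SeriesOver 𝔐≺𝔵 δ → ∀ ε → SeriesOver 𝔐≺𝔵 (δ ∘ (x⊕ ball ε))
      ∘-over-ball {δ} δ-over ε 𝔪∈ =
        let (𝔞 , 𝔞∈δ , 𝔪∈𝔞) = image-supp (Comp.isStronglyLinear (x⊕ ball ε)) δ 𝔪∈
        in ∘-over (proj₁ (δ-over 𝔞∈δ)) (λ 𝔪∈ε → proj₁ (proj₂ ε 𝔪∈ε)) (≺x (proj₂ (ball ε)))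
             (supp-resp-≈ (∘-congʳ (mono 𝔞) ≈.refl) 𝔪∈𝔞) ,
           ∘-⊰𝔵 {δ} (ball ε) (λ 𝔪∈δ → proj₂ (δ-over 𝔪∈δ)) 𝔪∈

      module _ {δ : Series} (δ-over : SeriesOver 𝔐≺𝔵 δ) where

        -- The map ε ↦ - δ ∘ (x + ε).  Its fixed points give right inverses of x + δ.
        correction : ∃ (SeriesOver 𝔐≺𝔵) → Series
        correction ε = - (δ ∘ (x⊕ ball ε))

        correction-over : ∀ ε → correction ε ∈ SeriesOver 𝔐≺𝔵
        correction-over ε 𝔪∈ = ∘-over-ball δ-over ε (supp-neg⁻ (δ ∘ (x⊕ ball ε)) 𝔪∈)

        correction-contracting : ∀ ε η 𝔫 → Agree≻ 𝔫 (proj₁ ε) (proj₁ η) →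
                                 Agree≽ 𝔫 (correction ε) (correction η)
        correction-contracting ε η 𝔫 agree 𝔫≼𝔪 = R.-‿cong
          (image-agree (Comp.isStronglyLinear (x⊕ ball ε)) (Comp.isStronglyLinear (x⊕ ball η)) δ
            λ 𝔞∈δ → mono-contracting (ball ε) (ball η) 𝔫 (proj₂ (δ-over 𝔞∈δ)) agree 𝔫≼𝔪)

        open FixedPoint 𝔐≺𝔵 correction correction-over correction-contracting

        -- The part of ε above 𝔫.
        above : Monomial → ∃ (SeriesOver 𝔐≺𝔵) → ∃ (SeriesOver 𝔐≺𝔵)
        above 𝔫 (ε , over) = truncate 𝔫 ε , λ 𝔪∈ → over (proj₂ (truncate-supp 𝔫 ε 𝔪∈))

        -- An approximant ε and a cut 𝔫 in its support such that 𝔞 can be expanded at the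
        -- part of x + ε above 𝔫, with increments having no monomial above 𝔫.
        Base : Monomial → Set (lsuc κ ⊔ ℓ)
        Base 𝔞 = Σ[ ε ∈ ∃ (SeriesOver 𝔐≺𝔵) ] ∃[ 𝔫 ]
          (Approximant ε × supp (proj₁ ε) 𝔫 × Controlled 𝔞 (ball (above 𝔫 ε)) 𝔫)

        -- The monomials occurring in the chosen approximant and in the Taylor coefficients
        -- of 𝔞 at its base, if a base exists.
        Generators : ∀ {𝔞} → Dec (Base 𝔞) → Pred Monomial ℓ
        Generators {𝔞} (yes (ε , 𝔫 , _)) =
          supp (proj₁ ε) ∪ λ 𝔪 → ∃[ k ] supp (∂^ k (mono 𝔞) ∘ (x⊕ ball (above 𝔫 ε))) 𝔪
        Generators (no _) _ = ⊥

        generators-small : ∀ {𝔞} (d : Dec (Base 𝔞)) → Small (Generators d)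
        generators-small {𝔞} (yes (ε , 𝔫 , _)) = small-∪ (proj₁ (wellBased (proj₁ ε)))
          (small-⋃ℕ λ k → proj₁ (wellBased (∂^ k (mono 𝔞) ∘ (x⊕ ball (above 𝔫 ε)))))
        generators-small (no _) = ⊥ , (λ ()) , λ ()

        private
          A = proj₁ (proj₁ (wellBased δ))
          monomialAt : A → Monomial
          monomialAt = proj₁ (proj₂ (proj₁ (wellBased δ)))
          covers : ∀ {𝔪} → supp δ 𝔪 → ∃[ a ] monomialAt a N.≈ 𝔪
          covers = proj₂ (proj₂ (proj₁ (wellBased δ)))

        -- The generators for all 𝔞 ∈ supp δ.  The index set A of supp δ may enumerate
        -- further monomials, which only add generators.  Excluded middle acts as choice.
        AllGenerators : Pred Monomial (κ ⊔ ℓ)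
        AllGenerators 𝔪 = ∃[ a ] Generators (em {P = Base (monomialAt a)}) 𝔪

        -- A monomial 𝔫 of an approximant ε that comes from the term at 𝔞 of δ.  Then 𝔞 has
        -- a base, since (ε , 𝔫) is one.  For the chosen base (η , 𝔟), either 𝔫 is at least 𝔟,
        -- where η already agrees with ε, or 𝔫 appears in the expansion of 𝔞 at the chosen base.
        generated-at : ∀ {𝔞 p} {Γ : Pred Monomial p} (d : Dec (Base 𝔞)) ε 𝔫 →
          𝔞 N.≺ 𝔵 → Approximant ε → supp (proj₁ ε) 𝔫 →
          supp (mono 𝔞 ∘ (x⊕ ball (above 𝔫 ε))) 𝔫 →
          Generators d ⊆ Γ → supp (truncate 𝔫 (proj₁ ε)) ⊆ Generated Γ → Generated Γ 𝔫
        generated-at (no none) ε 𝔫 𝔞≺𝔵 ap 𝔫∈ε 𝔫∈ _ _ = contradiction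
          (ε , 𝔫 , ap , 𝔫∈ε , decidable-stable em λ ¬c →
            N.≺-irrefl N.refl (¬controlled⇒⊰ (ball (above 𝔫 ε)) 𝔞≺𝔵 ¬c 𝔫∈)) none
        generated-at {𝔞} {Γ = Γ} (yes (η , 𝔟 , aq , 𝔟∈η , controlled)) ε 𝔫 𝔞≺𝔵 ap 𝔫∈ε 𝔫∈ ⊆Γ above⊆ =
          position em
          where
          agree : 𝔫 N.≺ 𝔟 → Agree≻ 𝔟 (truncate 𝔟 (proj₁ η)) (truncate 𝔫 (proj₁ ε))
          agree 𝔫≺𝔟 𝔟≺𝔪 = R.trans (truncate-agree 𝔟 (proj₁ η) 𝔟≺𝔪) (R.trans
            (coherent {η} {ε} aq ap 𝔟∈η 𝔫∈ε (≺⇒≼ 𝔟≺𝔪) (≺⇒≼ (N.≺-trans 𝔫≺𝔟 𝔟≺𝔪)))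
            (R.sym (truncate-agree 𝔫 (proj₁ ε) (N.≺-trans 𝔫≺𝔟 𝔟≺𝔪))))
          difference⊆ : supp (truncate 𝔫 (proj₁ ε) - truncate 𝔟 (proj₁ η)) ⊆ Generated Γ
          difference⊆ 𝔪∈ = [ above⊆ , (λ 𝔪∈η → generator (⊆Γ (inj₁ (proj₂
            (truncate-supp 𝔟 (proj₁ η) (supp-neg⁻ (truncate 𝔟 (proj₁ η)) 𝔪∈η)))))) ]′
            (+-supp (truncate 𝔫 (proj₁ ε)) (- truncate 𝔟 (proj₁ η)) 𝔪∈)
          position : Dec (𝔫 N.≺ 𝔟) → Generated Γ 𝔫
          position (no 𝔟≼𝔫) = generator (⊆Γ (inj₁ λ ≈0 → 𝔫∈ε
            (R.trans (coherent {ε} {η} ap aq 𝔫∈ε 𝔟∈η ≼-refl 𝔟≼𝔫) ≈0)))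
          position (yes 𝔫≺𝔟) =
            controlled-supp (ball (above 𝔟 η)) (ball (above 𝔫 ε)) 𝔞≺𝔵 controlled (agree 𝔫≺𝔟)
              (λ k 𝔪∈ → ⊆Γ (inj₂ (k , 𝔪∈))) difference⊆ 𝔫∈

        -- The monomial 𝔫 lies in the support of φ(ε), hence of φ of the part of ε above 𝔫,
        -- and thus comes from the term of δ at some 𝔞.
        generated-step : ∀ ε 𝔫 → Approximant ε → supp (proj₁ ε) 𝔫 →
          supp (truncate 𝔫 (proj₁ ε)) ⊆ Generated AllGenerators → Generated AllGenerators 𝔫
        generated-step ε 𝔫 ap 𝔫∈ε above⊆ =
          let (𝔪 , 𝔪∈δ , 𝔫∈𝔪∘s) = image-supp (Comp.isStronglyLinear s) δ 𝔫∈δ∘s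
              (a , a≈𝔪) = covers 𝔪∈δ
          in generated-at (em {P = Base (monomialAt a)}) ε 𝔫
               (N.≺-respˡ-≈ (N.sym a≈𝔪) (proj₂ (δ-over 𝔪∈δ))) ap 𝔫∈ε
               (supp-resp-≈ (∘-cong s (mono-cong (N.sym a≈𝔪))) 𝔫∈𝔪∘s)
               (λ 𝔪∈ → a , 𝔪∈) above⊆
          where
          s = x⊕ ball (above 𝔫 ε)
          𝔫∈δ∘s : supp (δ ∘ s) 𝔫
          𝔫∈δ∘s = supp-neg⁻ (δ ∘ s) λ ≈0 → 𝔫∈ε (R.trans (ap 𝔫 𝔫∈ε ≼-refl)
            (R.trans (correction-contracting ε (above 𝔫 ε) 𝔫
              (λ 𝔫≺𝔪 → R.sym (truncate-agree 𝔫 (proj₁ ε) 𝔫≺𝔪)) ≼-refl) ≈0))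

        -- Induction down the support of ε.
        approximant-generated : ∀ {ε} → Approximant ε → supp (proj₁ ε) ⊆ Generated AllGenerators
        approximant-generated {ε} ap {𝔫} 𝔫∈ε = descend 𝔫∈ε (proj₂ (wellBased (proj₁ ε)) (𝔫 , 𝔫∈ε))
          where
          descend : ∀ {𝔫} (𝔫∈ε : supp (proj₁ ε) 𝔫) → Acc (Reverse (supp (proj₁ ε))) (𝔫 , 𝔫∈ε) →
                    Generated AllGenerators 𝔫
          descend {𝔫} 𝔫∈ε (acc rs) = generated-step ε 𝔫 ap 𝔫∈ε λ 𝔪∈ →
            let (𝔫≺𝔪 , 𝔪∈ε) = truncate-supp 𝔫 (proj₁ ε) 𝔪∈ in descend 𝔪∈ε (rs {_ , 𝔪∈ε} 𝔫≺𝔪)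

        reached-small : Small Reached
        reached-small with small-generated (small-⋃ λ a → generators-small (em {P = Base (monomialAt a)}))
        ... | B , f , covers = B , f , λ (ε , ap , 𝔫∈ε) → covers (approximant-generated {ε} ap 𝔫∈ε)

        abstract
          solution : ∃[ ε ] (proj₁ ε ≈ correction ε)
          solution = (limit reached-small , limit-over reached-small) , limit-fixed reached-small

      -- The group of series x + δ

      near : ∃ (SeriesOver 𝔐≺𝔵) → 𝓖
      near ε = proj₁ (x⊕ ball ε) , proj₁ ε , (λ 𝔪∈ → proj₁ (proj₂ ε 𝔪∈)) , ≺x (proj₂ (ball ε)) , ≈.refl

      -- The series δ of an element x + δ.
      offset : 𝓖 → ∃ (SeriesOver 𝔐≺𝔵)
      offset (_ , δ , over , δ≺x , _) = δ , λ 𝔪∈ → over 𝔪∈ , ≺x⁻ {δ} δ≺x 𝔪∈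

      ≈x⊕offset : ∀ g → proj₁ g ≈ proj₁ (x⊕ ball (offset g))
      ≈x⊕offset (_ , _ , _ , _ , eq) = eq

      ∘-near : ∀ g ε → proj₁ g ∘ (x⊕ ball ε) ≈ proj₁ (x⊕ ball ε) + (proj₁ (offset g) ∘ (x⊕ ball ε))
      ∘-near g ε = ≈.trans (∘-cong (x⊕ ball ε) (≈x⊕offset g))
        (≈.trans (Comp.+-homo (x⊕ ball ε) (proj₁ x) (proj₁ (offset g)))
          (+-cong (proj₁ ∘-identity (x⊕ ball ε)) ≈.refl))

      +-assoc : ∀ s t u → (s + t) + u ≈ s + (t + u)
      +-assoc s t u = pointwise λ _ → R.+-assoc _ _ _

      closed : ∀ g h → (proj₁ g ∘ toSeries∞ h) ∈𝓖
      closed g h = ε + δ∘h , (λ 𝔪∈ → proj₁ (over 𝔪∈)) , ≺x (λ 𝔪∈ → proj₂ (over 𝔪∈)) ,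
        ≈.trans (∘-congʳ (proj₁ g) (≈x⊕offset h)) (≈.trans (∘-near g (offset h)) (+-assoc (proj₁ x) ε δ∘h))
        where
        ε = proj₁ (offset h)
        δ∘h = proj₁ (offset g) ∘ (x⊕ ball (offset h))
        over : SeriesOver 𝔐≺𝔵 (ε + δ∘h)
        over 𝔪∈ = [ proj₂ (offset h) , ∘-over-ball (proj₂ (offset g)) (offset h) ]′ (+-supp ε δ∘h 𝔪∈)

      identity : 𝓖
      identity = proj₁ x , 0ˢ , (λ ≉0 → contradiction R.refl ≉0) , ≺x (λ ≉0 → contradiction R.refl ≉0) ,
        pointwise λ _ → R.sym (R.+-identityʳ _)

      inverse : 𝓖 → 𝓖
      inverse g = near (proj₁ (solution {proj₁ (offset g)} (proj₂ (offset g))))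

      ∘-inverse : ∀ g → proj₁ g ∘ toSeries∞ (inverse g) ≈ proj₁ x
      ∘-inverse g =
        let (ε , ε≈-δ∘s) = solution {proj₁ (offset g)} (proj₂ (offset g))
        in ≈.trans (∘-congʳ (proj₁ g) ≈.refl) (≈.trans (∘-near g ε)
             (≈.trans (+-assoc (proj₁ x) (proj₁ ε) (proj₁ (offset g) ∘ (x⊕ ball ε))) (pointwise λ 𝔪 →
               R.trans (R.+-congˡ (R.trans (R.+-congʳ (at ε≈-δ∘s 𝔪)) (R.-‿inverseˡ _))) (R.+-identityʳ _))))

      isMonoid : IsMonoid _≈ᴳ_ (λ g h → (proj₁ g ∘ toSeries∞ h) , closed g h) identity
      isMonoid = record
        { isSemigroup = record
          { isMagma = record
            { isEquivalence = record { refl = ≈.refl ; sym = ≈.sym ; trans = ≈.trans }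
            ; ∙-cong = λ {g} {g′} {h} g≈g′ h≈h′ →
                ≈.trans (∘-cong (toSeries∞ h) g≈g′) (∘-congʳ (proj₁ g′) h≈h′)
            }
          ; assoc = λ g h k → ≈.trans (≈.sym (∘-assoc (proj₁ g) (toSeries∞ h) (toSeries∞ k)))
              (∘-congʳ (proj₁ g) ≈.refl)
          }
        ; identity = (λ g → proj₁ ∘-identity (toSeries∞ g)) ,
            λ g → ≈.trans (∘-congʳ (proj₁ g) ≈.refl) (proj₂ ∘-identity (proj₁ g))
        }

      isGroupUnder : IsGroupUnder _∘_
      isGroupUnder = closed , identity , inverse , rightInverses⇒isGroup isMonoid ∘-inverse

theorem3p1 :
  (em : ∀ {a} → ExcludedMiddle a) (κ : Level) {ℓ : Level}
  (𝐑 : OrderedField ℓ ℓ ℓ) (𝔑 : OrderedAbelianGroup ℓ ℓ ℓ) →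
  let open WellBasedSeries em κ 𝐑 𝔑 in
  N.NonTrivial →
  (log : Series⁺ → Series) →
  let open Transserial log in
  IsTransserialField log →
  ExponentiallyClosed log →
  (x : Series∞) →
  let x× = proj₁ x , positive⇒≉0 (infinite⇒positive (proj₂ x)) in
  (∂ : Series → Series) (∂-derivation : IsTransserialDerivation ∂) →
  IsIdentityOf ∂ (proj₁ x) →
  IsHField ∂ →
  IsFlatDerivation ∂ x× →
  (_∘_ : Series → Series∞ → Series) (∘-law : IsCompositionLaw _∘_) →
  IsCompositionIdentity _∘_ x →
  IsFlatComposition _∘_ →
  ChainRule ∂ _∘_ →
  Taylor.HasTaylorExpansions ∂-derivation ∘-law →
  (𝔐 : Pred Monomial ℓ) →
  N.IsSubgroup 𝔐 →
  (∃[ 𝔵 ] (𝔵 ∈ 𝔐 × proj₁ x ≈ mono 𝔵)) →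
  (∀ {s} → s ∈ SeriesOver 𝔐 → ∂ s ∈ SeriesOver 𝔐) →
  (∀ {𝔪 δ} → 𝔪 ∈ 𝔐 → δ ∈ SeriesOver 𝔐 → (δ≺x : δ ≺ proj₁ x) →
    (mono 𝔪 ∘ (x +∞ δ ⟨ δ≺x ⟩)) ∈ SeriesOver 𝔐) →
  NearIdentity.IsGroupUnder 𝔐 x _∘_
theorem3p1 em κ 𝐑 𝔑 _ log _ _ x ∂ ∂-derivation (_ , _ , ∂x≈1) hField _ _∘_ ∘-law ∘-identity _ _ taylor
  𝔐 _ (𝔵 , _ , x≈𝔵) _ ∘-over =
  CompositionNearIdentity.isGroupUnder em κ 𝐑 𝔑 log x 𝔵 x≈𝔵 ∂ ∂-derivation ∂x≈1 hField
    _∘_ ∘-law ∘-identity taylor 𝔐 ∘-over
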